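{- If $G$ is a triangle-free connected graph with $G\in\mathcal{G}^{\mathrm{cs}}$ and $G$ is not a cycle, then $\mathrm{diam}(G)\le 3$.
   Context: All graphs are finite and simple. A weight function on $V(G)$ is a map $w:V(G)\to\mathbb{R}_{>0}$; for $X\subseteq V(G)$ put $w(X)=\sum_{v\in X}w(v)$. A non-empty set $S\subseteq V(G)$ is a weighted safe set of $(G,w)$ if for every component $C$ of the induced subgraph $G[S]$ and every component $D$ of $G-S$ such that some edge joins $C$ and $D$, we have $w(C)\ge w(D)$. It is a connected weighted safe set if moreover $G[S]$ is connected. $\mathrm{s}(G,w)$ (resp. $\mathrm{cs}(G,w)$) is the minimum of $w(S)$ over all weighted safe sets (resp. connected weighted safe sets) $S$ of $(G,w)$. $\mathcal{G}^{\mathrm{cs}}$ denotes the family of all graphs $G$ such that $\mathrm{s}(G,w)=\mathrm{cs}(G,w)$ for every weight function $w$ on $V(G)$. -}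

module Defs where

open import Data.Nat using (ℕ; zero; suc; _≤_)
open import Data.Fin using (Fin; toℕ) renaming (zero to fz; suc to fs)
open import Data.Bool using (Bool; true; false; not; if_then_else_)
open import Data.Rational using (ℚ; 0ℚ; _+_) renaming (_≤_ to _≤ℚ_; _<_ to _<ℚ_)
open import Data.Product using (Σ; ∃; _×_; _,_)
open import Data.Sum using (_⊎_)
open import Data.Empty using (⊥)
open import Relation.Nullary using (¬_)
open import Relation.Binary.PropositionalEquality using (_≡_)
open import Function.Definitions using (Bijective)
open import Function.Bundles using (_⇔_)

record Graph (n : ℕ) : Set where
  field
    adj   : Fin n → Fin n → Bool
    sym   : ∀ x y → adj x y ≡ adj y x
    irrefl : ∀ x → adj x x ≡ false
open Graph public

VSet : ℕ → Set
VSet n = Fin n → Bool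

_∈_ : ∀ {n} → Fin n → VSet n → Set
x ∈ A = A x ≡ true

_⊆_ : ∀ {n} → VSet n → VSet n → Set
A ⊆ B = ∀ x → x ∈ A → x ∈ B

complement : ∀ {n} → VSet n → VSet n
complement A x = not (A x)

full : ∀ {n} → VSet n
full _ = true

data WalkIn {n} (G : Graph n) (A : VSet n) : ℕ → Fin n → Fin n → Set where
  here : ∀ {x} → x ∈ A → WalkIn G A zero x x
  step : ∀ {k x y z} → WalkIn G A k x y → adj G y z ≡ true → z ∈ A →
         WalkIn G A (suc k) x z

ReachIn : ∀ {n} → Graph n → VSet n → Fin n → Fin n → Set
ReachIn G A x y = ∃ λ k → WalkIn G A k x y

ConnectedIn : ∀ {n} → Graph n → VSet n → Set
ConnectedIn G A = (∃ λ x → x ∈ A) × (∀ x y → x ∈ A → y ∈ A → ReachIn G A x y)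

Connected : ∀ {n} → Graph n → Set
Connected G = ConnectedIn G full

-- C is a connected component of G[X]: a nonempty connected subset of X
-- closed under adjacency inside X (i.e. a maximal connected subset).
IsComponent : ∀ {n} → Graph n → VSet n → VSet n → Set
IsComponent G X C =
  C ⊆ X × ConnectedIn G C ×
  (∀ x y → x ∈ C → y ∈ X → adj G x y ≡ true → y ∈ C)

sumFin : ∀ n → (Fin n → ℚ) → ℚ
sumFin zero    f = 0ℚ
sumFin (suc n) f = f fz + sumFin n (λ i → f (fs i))

Weight : ℕ → Set
Weight n = Fin n → ℚ

PositiveWeight : ∀ {n} → Weight n → Set
PositiveWeight w = ∀ v → 0ℚ <ℚ w v

wt : ∀ {n} → Weight n → VSet n → ℚ
wt {n} w X = sumFin n (λ v → if X v then w v else 0ℚ)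

IsWSafe : ∀ {n} → Graph n → Weight n → VSet n → Set
IsWSafe G w S =
  (∃ λ x → x ∈ S) ×
  (∀ C D → IsComponent G S C → IsComponent G (complement S) D →
     (∃ λ c → ∃ λ d → c ∈ C × d ∈ D × adj G c d ≡ true) →
     wt w D ≤ℚ wt w C)

IsConnWSafe : ∀ {n} → Graph n → Weight n → VSet n → Set
IsConnWSafe G w S = IsWSafe G w S × ConnectedIn G S

IsMinWt : ∀ {n} → Weight n → (VSet n → Set) → ℚ → Set
IsMinWt w P m = (∃ λ S → P S × wt w S ≡ m) × (∀ S → P S → m ≤ℚ wt w S)

InGcs : ∀ {n} → Graph n → Set
InGcs G = ∀ w → PositiveWeight w → ∀ s cs →
  IsMinWt w (IsWSafe G w) s → IsMinWt w (IsConnWSafe G w) cs → s ≡ cs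

TriangleFree : ∀ {n} → Graph n → Set
TriangleFree G = ∀ x y z → adj G x y ≡ true → adj G y z ≡ true → adj G x z ≡ true → ⊥

CycStep : ∀ {n} → Fin n → Fin n → Set
CycStep {n} i j = suc (toℕ i) ≡ toℕ j ⊎ (suc (toℕ i) ≡ n × toℕ j ≡ 0)

CycAdj : ∀ {n} → Fin n → Fin n → Set
CycAdj i j = CycStep i j ⊎ CycStep j i

IsCycle : ∀ {n} → Graph n → Set
IsCycle {n} G = 3 ≤ n × Σ (Fin n → Fin n) λ f → Bijective _≡_ _≡_ f ×
  (∀ i j → (adj G (f i) (f j) ≡ true) ⇔ CycAdj i j)

DiamLe : ∀ {n} → Graph n → ℕ → Set
DiamLe G d = ∀ x y → ∃ λ k → k ≤ d × WalkIn G full k x y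

{-# OPTIONS --safe #-}
module Submission where

-- Suppose x and y have distance at least 4. For a vertex t let H t be the graph without the
-- closed neighbourhood of t, and call t nice if H t is connected, every neighbour of t has a
-- neighbour in H t, and t has at least two neighbours. Integer weights with a cheap
-- disconnected safe set and no connected safe set of at most that weight refute membership
-- in 𝒢^cs; three such weightings are used.
--   * A nice vertex has exactly two neighbours (a weighted K₂,₃ with one part blown up to H t).
--   * If y is nice, no vertex j of H y at distance at least 3 from y leaves H y ∖ j connected
--     (a weighted 4-cycle with a pendant vertex). Hence a connected subset of H y which
--     contains all vertices of H y at distance 2 from y is all of H y.
--   * If neither x nor y is nice, each of them has a part J of the graph hanging on a
--     connected set U inside its closed neighbourhood, and the two parts form the ends of a
--     weighted path on five vertices.
-- So one of x, y is nice, say y. By the second point every vertex at distance at least 3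
-- from y is nice too, in particular x and both its neighbours. The second point for x
-- then says that H x is a shortest path between the outer neighbours of the two
-- neighbours of x, so the graph is a cycle.

open import Defs
open import Data.Nat using (ℕ; zero; suc; pred; _+_; _*_; _≤_; _<_; z≤n; s≤s)
import Data.Nat.Properties as ℕ
open import Algebra.Properties.CommutativeSemigroup ℕ.+-commutativeSemigroup using (x∙yz≈y∙xz)
open import Data.Nat.Induction using (<-rec)
open import Data.Nat.Tactic.RingSolver using (solve-∀)
open import Data.Fin using (Fin; toℕ; fromℕ<) renaming (zero to fz; suc to fs)
open import Data.Fin.Properties using (_≟_; any?)
import Data.Fin.Properties as Fin
open import Data.Bool using (Bool; true; false; if_then_else_)
import Data.Bool.Properties as Bool
open import Data.Rational using (ℚ; 0ℚ; 1ℚ) renaming (_+_ to _+ℚ_; _≤_ to _≤ℚ_; _<_ to _<ℚ_)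
import Data.Rational.Properties as ℚ
open import Data.List using (List; []; _∷_; map)
open import Data.Nat.ListAction using (sum)
open import Data.List.Relation.Unary.All as All using (All; []; _∷_)
open import Data.List.Relation.Unary.Any using (here; there)
open import Data.List.Relation.Unary.AllPairs using ([]; _∷_)
open import Data.List.Relation.Unary.Unique.Propositional using (Unique)
open import Data.List.Relation.Binary.Pointwise using (Pointwise; []; _∷_)
import Data.List.Membership.Propositional as List
open import Data.Product using (Σ; ∃; _×_; _,_; proj₁; proj₂; uncurry)
open import Data.Sum using (_⊎_; inj₁; inj₂; [_,_]′)
open import Data.Empty using (⊥; ⊥-elim)
open import Function using (_∘_; id; case_of_)
open import Function.Bundles using (_⇔_; mk⇔)
open import Function.Definitions using (Injective)
open import Relation.Binary.Definitions using (tri<; tri≈; tri>)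
open import Relation.Nullary using (¬_; Dec; yes; no; does; contradiction; ¬?; _×-dec_; _⊎-dec_)
open import Relation.Nullary.Decidable using (dec-true; dec-false; decidable-stable)
open import Relation.Binary.PropositionalEquality using (_≡_; _≢_; refl; trans; cong; cong₂; subst; subst₂; ≢-sym) renaming (sym to ≡-sym)

private variable
  n : ℕ

-- Vertex sets

_∈?_ : (v : Fin n) (A : VSet n) → Dec (v ∈ A)
v ∈? A = A v Bool.≟ true

-- Opaque so that v can be inferred from v ∈ ⟦ P? ⟧.
opaque
  ⟦_⟧ : {P : Fin n → Set} → (∀ v → Dec (P v)) → VSet n
  ⟦ P? ⟧ v = does (P? v)

  ∈⁺ : {P : Fin n → Set} (P? : ∀ v → Dec (P v)) → ∀ {v} → P v → v ∈ ⟦ P? ⟧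
  ∈⁺ P? {v} p = dec-true (P? v) p

  ∈⁻ : {P : Fin n → Set} (P? : ∀ v → Dec (P v)) → ∀ {v} → v ∈ ⟦ P? ⟧ → P v
  ∈⁻ P? {v} e with P? v
  ... | yes p = p
  ... | no _ with () ← e

∉⇒∈∁ : ∀ (A : VSet n) {v} → ¬ v ∈ A → v ∈ complement A
∉⇒∈∁ A {v} v∉ with A v
... | true  = contradiction refl v∉
... | false = refl

∈∁⇒∉ : ∀ (A : VSet n) {v} → v ∈ complement A → ¬ v ∈ A
∈∁⇒∉ A {v} e v∈ with A v | e | v∈
... | true | () | _

sub? : ∀ (A B : VSet n) → (∃ λ v → v ∈ A × ¬ v ∈ B) ⊎ A ⊆ B
sub? A B with any? (λ v → (v ∈? A) ×-dec ¬? (v ∈? B))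
... | yes e = inj₁ e
... | no ¬e = inj₂ λ v v∈A → decidable-stable (v ∈? B) λ v∉B → ¬e (v , v∈A , v∉B)

-- Every goal below is refuted by contradiction, so an undecided predicate may
-- be replaced by a Boolean one.
comprehension : (P : Fin n → Set) →
  ¬ ¬ (Σ (VSet n) λ C → ∀ v → (v ∈ C → P v) × (P v → v ∈ C))
comprehension {zero}  P k = k ((λ ()) , λ ())
comprehension {suc n} P k = comprehension (P ∘ fs) λ (C , spec) →
  let extend : (b : Bool) → (b ≡ true → P fz) → (P fz → b ≡ true) → ⊥
      extend b to from = k ((λ { fz → b ; (fs v) → C v }) ,
                            λ { fz → to , from ; (fs v) → spec v })
  -- `false` is tried first: it can fail only on a proof of `P fz`, and such a proof makes `true`
  -- correct.
  in extend false (λ ()) λ p → ⊥-elim (extend true (λ _ → p) (λ _ → refl))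

-- Walks and connectedness

module _ {G : Graph n} where

  adj-sym : ∀ {u v} → adj G u v ≡ true → adj G v u ≡ true
  adj-sym {u} {v} e = trans (sym G v u) e

  adj⇒≢ : ∀ {u v} → adj G u v ≡ true → u ≢ v
  adj⇒≢ {u} e refl with () ← trans (≡-sym e) (irrefl G u)

  walk-source : ∀ {A k u v} → WalkIn G A k u v → u ∈ A
  walk-source (here u∈A) = u∈A
  walk-source (step w _ _) = walk-source w

  walk-target : ∀ {A k u v} → WalkIn G A k u v → v ∈ A
  walk-target (here u∈A) = u∈A
  walk-target (step _ _ v∈A) = v∈A

  infixr 5 _++ʷ_

  _++ʷ_ : ∀ {A j k u v x} → WalkIn G A j u v → WalkIn G A k v x → WalkIn G A (k + j) u x
  w ++ʷ here _ = w
  w ++ʷ step w′ e x∈A = step (w ++ʷ w′) e x∈A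

  reach-trans : ∀ {A u v x} → ReachIn G A u v → ReachIn G A v x → ReachIn G A u x
  reach-trans (_ , w) (_ , w′) = _ , w ++ʷ w′

  reach-edge : ∀ {A u v} → u ∈ A → v ∈ A → adj G u v ≡ true → ReachIn G A u v
  reach-edge u∈A v∈A e = 1 , step (here u∈A) e v∈A

  reach-sym : ∀ {A u v} → ReachIn G A u v → ReachIn G A v u
  reach-sym (_ , here u∈A) = _ , here u∈A
  reach-sym (_ , step w e v∈A) =
    reach-trans (reach-edge v∈A (walk-target w) (adj-sym e)) (reach-sym (_ , w))

  walk-transport : ∀ {A k u v} (P : Fin n → Set) →
    (∀ {x y} → x ∈ A → y ∈ A → adj G x y ≡ true → P x → P y) →
    WalkIn G A k u v → P u → P v
  walk-transport P next (here _) p = p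
  walk-transport P next (step w e v∈A) p =
    next (walk-target w) v∈A e (walk-transport P next w p)

  walk-restrict : ∀ {A k u v} (C : VSet n) →
    (∀ {x y} → x ∈ C → y ∈ A → adj G x y ≡ true → y ∈ C) →
    WalkIn G A k u v → u ∈ C → WalkIn G C k u v
  walk-restrict C next (here _) p = here p
  walk-restrict C next (step w e v∈A) p =
    let w′ = walk-restrict C next w p
    in step w′ e (next (walk-target w′) v∈A e)

  walk-mono : ∀ {A B k u v} → A ⊆ B → WalkIn G A k u v → WalkIn G B k u v
  walk-mono A⊆B (here p) = here (A⊆B _ p)
  walk-mono A⊆B (step w e p) = step (walk-mono A⊆B w) e (A⊆B _ p)

  hub⇒connected : ∀ {A c} → c ∈ A → (∀ {v} → v ∈ A → ReachIn G A c v) → ConnectedIn G A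
  hub⇒connected c∈A reach =
    (_ , c∈A) , λ u v u∈A v∈A → reach-trans (reach-sym (reach u∈A)) (reach v∈A)

  star⇒connected : ∀ {A c} → c ∈ A → (∀ {v} → v ∈ A → v ≡ c ⊎ adj G c v ≡ true) →
    ConnectedIn G A
  star⇒connected {A} {c} c∈A star = hub⇒connected c∈A λ v∈A → case star v∈A of λ where
    (inj₁ refl) → _ , here c∈A
    (inj₂ e)    → reach-edge c∈A v∈A e

  -- With `P` membership in a set closed along the edges of `A`, a connected `A` that meets the set
  -- lies inside it; this is how components are shown to swallow connected pieces.
  connected-transport : ∀ {A u v} (P : Fin n → Set) → ConnectedIn G A →
    (∀ {x y} → x ∈ A → y ∈ A → adj G x y ≡ true → P x → P y) →
    u ∈ A → v ∈ A → P u → P v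
  connected-transport P (_ , reach) next u∈A v∈A =
    walk-transport P next (proj₂ (reach _ _ u∈A v∈A))

  exit-edge : ∀ {A} (D : VSet n) → ConnectedIn G A → ∀ {u v} → u ∈ A → v ∈ A →
    u ∈ D → ¬ v ∈ D →
    ∃ λ x → ∃ λ y → x ∈ A × y ∈ A × x ∈ D × ¬ y ∈ D × adj G x y ≡ true
  exit-edge {A} D (_ , reach) u∈A v∈A u∈D v∉D = go (proj₂ (reach _ _ u∈A v∈A)) v∉D
    where
    go : ∀ {k v} → WalkIn G A k _ v → ¬ v ∈ D → _
    go (here _) v∉D = contradiction u∈D v∉D
    go (step {y = y} w e z∈A) z∉D with y ∈? D
    ... | yes y∈D = _ , _ , walk-target w , z∈A , y∈D , z∉D , e
    ... | no y∉D = go w y∉D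

  neighbour-in : ∀ {A u v} → ConnectedIn G A → u ∈ A → v ∈ A → u ≢ v →
    ∃ λ x → x ∈ A × adj G u x ≡ true
  neighbour-in {A} {u} conn u∈A v∈A u≢v
    with exit-edge ⟦ _≟ u ⟧ conn u∈A v∈A (∈⁺ (_≟ u) refl) (λ v∈ → u≢v (≡-sym (∈⁻ (_≟ u) v∈)))
  ... | x , y , _ , y∈A , x∈ , _ , e with refl ← ∈⁻ (_≟ u) x∈ = y , y∈A , e

-- Natural-number weights

∑ : ∀ n → (Fin n → ℕ) → ℕ
∑ zero    f = 0
∑ (suc n) f = f fz + ∑ n (f ∘ fs)

wtℕ : (Fin n → ℕ) → VSet n → ℕ
wtℕ {n} w X = ∑ n (λ v → if X v then w v else 0)

∑-cong : ∀ n {f g : Fin n → ℕ} → (∀ v → f v ≡ g v) → ∑ n f ≡ ∑ n g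
∑-cong zero    e = refl
∑-cong (suc n) e = cong₂ _+_ (e fz) (∑-cong n (e ∘ fs))

∑-mono : ∀ n {f g : Fin n → ℕ} → (∀ v → f v ≤ g v) → ∑ n f ≤ ∑ n g
∑-mono zero    e = z≤n
∑-mono (suc n) e = ℕ.+-mono-≤ (e fz) (∑-mono n (e ∘ fs))

∑-remove : ∀ n (f g : Fin n → ℕ) v → (∀ u → u ≢ v → f u ≡ g u) → g v ≡ 0 →
  ∑ n f ≡ f v + ∑ n g
∑-remove (suc n) f g fz e z rewrite z =
  cong (f fz +_) (∑-cong n λ u → e (fs u) λ ())
∑-remove (suc n) f g (fs v) e z
  rewrite e fz (λ ())
        | ∑-remove n (f ∘ fs) (g ∘ fs) v (λ u u≢v → e (fs u) (u≢v ∘ Fin.suc-injective)) z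
  = x∙yz≈y∙xz (g fz) (f (fs v)) (∑ n (g ∘ fs))

∑-bound : ∀ n {f : Fin n → ℕ} c → (∀ v → f v ≤ c) → ∑ n f ≤ n * c
∑-bound zero    c b = z≤n
∑-bound (suc n) c b = ℕ.+-mono-≤ (b fz) (∑-bound n c (b ∘ fs))

∑-scale : ∀ n (f : Fin n → ℕ) c → ∑ n (λ v → c * f v) ≡ c * ∑ n f
∑-scale zero    f c = ≡-sym (ℕ.*-zeroʳ c)
∑-scale (suc n) f c =
  trans (cong (c * f fz +_) (∑-scale n (f ∘ fs) c)) (≡-sym (ℕ.*-distribˡ-+ c (f fz) _))

∣_∣ : VSet n → ℕ
∣ X ∣ = wtℕ (λ _ → 1) X

∅ : VSet n
∅ _ = false

_∖_ : VSet n → Fin n → VSet n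
X ∖ v = ⟦ (λ u → (u ∈? X) ×-dec ¬? (u ≟ v)) ⟧

∈∖⁺ : ∀ (X : VSet n) {u v} → u ∈ X → u ≢ v → u ∈ (X ∖ v)
∈∖⁺ X {v = v} u∈X u≢v = ∈⁺ (λ u → (u ∈? X) ×-dec ¬? (u ≟ v)) (u∈X , u≢v)

∈∖⁻ : ∀ (X : VSet n) {u v} → u ∈ (X ∖ v) → u ∈ X × u ≢ v
∈∖⁻ X {v = v} = ∈⁻ (λ u → (u ∈? X) ×-dec ¬? (u ≟ v))

module _ (w : Fin n → ℕ) where

  wt-mono : ∀ {X Y} → X ⊆ Y → wtℕ w X ≤ wtℕ w Y
  wt-mono {X} {Y} X⊆Y = ∑-mono n pointwise
    where
    pointwise : ∀ v → (if X v then w v else 0) ≤ (if Y v then w v else 0)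
    pointwise v with X v in eq
    ... | false = z≤n
    ... | true rewrite X⊆Y v eq = ℕ.≤-refl

  wt-∅ : wtℕ w ∅ ≡ 0
  wt-∅ = ℕ.n≤0⇒n≡0 (subst (∑ n (λ _ → 0) ≤_) (ℕ.*-zeroʳ n) (∑-bound n 0 (λ _ → z≤n)))

  wt-bound : ∀ {X} c → (∀ {v} → v ∈ X → w v ≤ c) → wtℕ w X ≤ n * c
  wt-bound {X} c b = ∑-bound n c pointwise
    where
    pointwise : ∀ v → (if X v then w v else 0) ≤ c
    pointwise v with X v in eq
    ... | false = z≤n
    ... | true  = b eq

  wt-const : ∀ {X} c → (∀ {v} → v ∈ X → w v ≡ c) → wtℕ w X ≡ c * ∣ X ∣
  wt-const {X} c e = trans (∑-cong n pointwise) (∑-scale n _ c)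
    where
    pointwise : ∀ v → (if X v then w v else 0) ≡ c * (if X v then 1 else 0)
    pointwise v with X v in eq
    ... | false = ≡-sym (ℕ.*-zeroʳ c)
    ... | true  = trans (e eq) (≡-sym (ℕ.*-identityʳ c))

  wt-∖ : ∀ {X v} → v ∈ X → wtℕ w X ≡ w v + wtℕ w (X ∖ v)
  wt-∖ {X} {v} v∈X = trans (∑-remove n _ _ v same gone) (cong (_+ wtℕ w (X ∖ v)) value)
    where
    value : (if X v then w v else 0) ≡ w v
    value rewrite v∈X = refl
    gone : (if (X ∖ v) v then w v else 0) ≡ 0
    gone with (X ∖ v) v in eq
    ... | false = refl
    ... | true  = contradiction refl (proj₂ (∈∖⁻ X eq))
    same : ∀ u → u ≢ v → (if X u then w u else 0) ≡ (if (X ∖ v) u then w u else 0)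
    same u u≢v with X u in eq
    ... | true rewrite ∈∖⁺ X eq u≢v = refl
    ... | false with (X ∖ v) u in eq′
    ...   | false = refl
    ...   | true with () ← trans (≡-sym eq) (proj₁ (∈∖⁻ X eq′))

  -- Later estimates name a few heavy vertices in `l` and keep at most one whole set `Y` of known
  -- weight; the induction splits off the listed vertices with `wt-∖`.
  wt-lower : ∀ l {X Y} → Unique l → All (_∈ X) l → Y ⊆ X → All (λ v → ¬ v ∈ Y) l →
    sum (map w l) + wtℕ w Y ≤ wtℕ w X
  wt-lower [] _ _ Y⊆X _ = wt-mono Y⊆X
  wt-lower (v ∷ l) {X} {Y} (v∉l ∷ uniq) (v∈X ∷ l⊆X) Y⊆X (v∉Y ∷ disj) =
    subst₂ _≤_ (≡-sym (ℕ.+-assoc (w v) _ _)) (≡-sym (wt-∖ v∈X))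
      (ℕ.+-monoʳ-≤ (w v) (wt-lower l uniq
        (All.zipWith (λ (u∈X , v≢u) → ∈∖⁺ X u∈X (≢-sym v≢u)) (l⊆X , v∉l))
        (λ u u∈Y → ∈∖⁺ X (Y⊆X u u∈Y) λ { refl → v∉Y u∈Y }) disj))

  wt-lower′ : ∀ l {X} → Unique l → All (_∈ X) l → sum (map w l) ≤ wtℕ w X
  wt-lower′ l {X} uniq l⊆X =
    ℕ.≤-trans (ℕ.m≤m+n _ _) (wt-lower l {Y = ∅} uniq l⊆X (λ _ ()) (All.universal (λ _ ()) l))

  wt-upper : ∀ l {X Y} → (∀ {v} → v ∈ X → v List.∈ l ⊎ v ∈ Y) →
    wtℕ w X ≤ sum (map w l) + wtℕ w Y
  wt-upper [] cover = wt-mono λ v v∈X → case cover v∈X of λ where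
    (inj₁ ())
    (inj₂ v∈Y) → v∈Y
  wt-upper (v ∷ l) {X} {Y} cover = ℕ.≤-trans remove
    (subst (w v + wtℕ w (X ∖ v) ≤_) (≡-sym (ℕ.+-assoc (w v) _ _))
      (ℕ.+-monoʳ-≤ (w v) (wt-upper l cover′)))
    where
    remove : wtℕ w X ≤ w v + wtℕ w (X ∖ v)
    remove with v ∈? X
    ... | yes v∈X = ℕ.≤-reflexive (wt-∖ v∈X)
    ... | no v∉X = ℕ.≤-trans (wt-mono λ u u∈X → ∈∖⁺ X u∈X λ { refl → v∉X u∈X }) (ℕ.m≤n+m _ _)
    cover′ : ∀ {u} → u ∈ (X ∖ v) → u List.∈ l ⊎ u ∈ Y
    cover′ u∈ with ∈∖⁻ X u∈
    ... | u∈X , u≢v with cover u∈X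
    ...   | inj₁ (here u≡v)  = contradiction u≡v u≢v
    ...   | inj₁ (there u∈l) = inj₁ u∈l
    ...   | inj₂ u∈Y = inj₂ u∈Y

  -- The unlisted vertices are light, and their number is bounded crudely by `n`.
  wt-upper′ : ∀ l {X} c → (∀ {v} → v ∈ X → v List.∈ l ⊎ w v ≤ c) →
    wtℕ w X ≤ sum (map w l) + n * c
  wt-upper′ l {X} c cover = ℕ.≤-trans
    (wt-upper l λ v∈X → case cover v∈X of λ where
      (inj₁ v∈l) → inj₁ v∈l
      (inj₂ b)   → inj₂ (∈⁺ light? b))
    (ℕ.+-monoʳ-≤ (sum (map w l)) (wt-bound c (∈⁻ light?)))
    where
    light? : ∀ v → Dec (w v ≤ c)
    light? v = w v ℕ.≤? c

-- Passing to rational weights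

-- The embedding of ℕ by repeated addition of 1, which makes additivity and monotonicity plain
-- inductions.
ι : ℕ → ℚ
ι zero    = 0ℚ
ι (suc k) = 1ℚ +ℚ ι k

ι-+ : ∀ j k → ι (j + k) ≡ ι j +ℚ ι k
ι-+ zero    k = ≡-sym (ℚ.+-identityˡ (ι k))
ι-+ (suc j) k = trans (cong (1ℚ +ℚ_) (ι-+ j k)) (≡-sym (ℚ.+-assoc 1ℚ (ι j) (ι k)))

ι-nonneg : ∀ k → 0ℚ ≤ℚ ι k
ι-pos : ∀ k → 0ℚ <ℚ ι (suc k)
ι-nonneg zero    = ℚ.≤-refl
ι-nonneg (suc k) = ℚ.<⇒≤ (ι-pos k)
ι-pos k = subst (_<ℚ ι (suc k)) (ℚ.+-identityˡ 0ℚ) (ℚ.+-mono-<-≤ (ℚ.positive⁻¹ 1ℚ) (ι-nonneg k))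

ι-mono : ∀ {j k} → j ≤ k → ι j ≤ℚ ι k
ι-mono {k = k} z≤n = ι-nonneg k
ι-mono (s≤s j≤k) = ℚ.+-monoʳ-≤ 1ℚ (ι-mono j≤k)

ι-mono-< : ∀ {j k} → j < k → ι j <ℚ ι k
ι-mono-< {zero}  {suc k} _ = ι-pos k
ι-mono-< {suc j} {suc k} (s≤s j<k) = ℚ.+-monoʳ-< 1ℚ (ι-mono-< j<k)

ι-cancel : ∀ {j k} → ι j ≤ℚ ι k → j ≤ k
ι-cancel {j} {k} le = ℕ.≮⇒≥ λ k<j → ℚ.<-irrefl refl (ℚ.<-≤-trans (ι-mono-< k<j) le)

wt-ι : (w : Fin n → ℕ) (X : VSet n) → wt (ι ∘ w) X ≡ ι (wtℕ w X)
wt-ι w X = go _ w X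
  where
  go : ∀ n (w : Fin n → ℕ) X → wt (ι ∘ w) X ≡ ι (wtℕ w X)
  go zero    w X = refl
  go (suc n) w X = trans (cong₂ _+ℚ_ first (go n (w ∘ fs) (X ∘ fs)))
                     (≡-sym (ι-+ (if X fz then w fz else 0) (wtℕ (w ∘ fs) (X ∘ fs))))
    where
    first : (if X fz then ι (w fz) else 0ℚ) ≡ ι (if X fz then w fz else 0)
    first with X fz
    ... | true  = refl
    ... | false = refl

-- Minimum safe sets and a criterion for refuting membership in 𝒢^cs

-- Strong induction on the natural-number weight; `P` is undecided, so the minimum is obtained only
-- up to double negation.
min-exists : (w : Fin n → ℕ) (P : VSet n → Set) → ∀ {S} → P S →
  ¬ ¬ (∃ λ S → P S × (∀ T → P T → wtℕ w S ≤ wtℕ w T))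
min-exists {n} w P {S} p k = <-rec (λ m → ∀ S → P S → wtℕ w S ≡ m → ⊥) descend _ S p refl
  where
  descend : ∀ m → (∀ {j} → j < m → ∀ S → P S → wtℕ w S ≡ j → ⊥) → ∀ S → P S → wtℕ w S ≡ m → ⊥
  descend m ih S p refl = k (S , p , λ T q → ℕ.≮⇒≥ λ T<S → ih T<S T q refl)

module _ {G : Graph n} (conn : Connected G) where

  -- The component is the set of vertices reachable inside `A` from a vertex of `D`, available
  -- through `comprehension` up to double negation.
  component-⊇ : ∀ {A D} → ConnectedIn G D → D ⊆ A → ¬ ¬ (∃ λ C → IsComponent G A C × D ⊆ C)
  component-⊇ {A} ((d , d∈D) , reachD) D⊆A k = comprehension (ReachIn G A d) λ (C , spec) →
    let d∈C = proj₂ (spec d) (_ , here (D⊆A d d∈D))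
        closed : ∀ {x y} → x ∈ C → y ∈ A → adj G x y ≡ true → y ∈ C
        closed x∈C y∈A e = proj₂ (spec _)
          (reach-trans (proj₁ (spec _) x∈C) (reach-edge (walk-target (proj₂ (proj₁ (spec _) x∈C))) y∈A e))
    in k (C , ((λ x x∈C → walk-target (proj₂ (proj₁ (spec x) x∈C))) ,
               hub⇒connected d∈C (λ {v} v∈C →
                 _ , walk-restrict C closed (proj₂ (proj₁ (spec v) v∈C)) d∈C) ,
               (λ x y → closed)) ,
         λ v v∈D → proj₂ (spec v) (_ , walk-mono D⊆A (proj₂ (reachD d v d∈D v∈D))))

  -- Nothing lies outside the full set, so safety is vacuous; it supplies the connected safe set
  -- from which a minimum is sought.
  full-safe : ∀ w → IsConnWSafe G w full
  full-safe w = (proj₁ conn , λ { C D _ (D⊆∅ , ((d , d∈D) , _) , _) _ → case D⊆∅ d d∈D of λ () }) , conn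

  -- For connected T, safety says that no connected set avoiding T outweighs it.
  safe⇒heaviest : ∀ (w : Fin n → ℕ) {T} → IsConnWSafe G (ι ∘ w) T →
    ∀ D → ConnectedIn G D → D ⊆ complement T → ¬ wtℕ w T < wtℕ w D
  safe⇒heaviest w {T} ((_ , safe) , connT@((t , t∈T) , _)) D connD@((d , d∈D) , _) D⊆ T<D =
    component-⊇ connD D⊆ λ (C , comp@(C⊆ , connC , closed) , D⊆C) →
      -- `C` is closed in the complement of `T`, so the edge leaving `C` on the way to `t` ends in
      -- `T`, and safety compares `T` with `C`.
      let u , v , _ , _ , u∈C , v∉C , e = exit-edge C conn {d} {t} refl refl (D⊆C d d∈D)
            (λ t∈C → ∈∁⇒∉ T (C⊆ t t∈C) t∈T)
          v∈T = decidable-stable (v ∈? T) λ v∉T → v∉C (closed u v u∈C (∉⇒∈∁ T v∉T) e)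
          le = safe T C ((λ _ p → p) , connT , (λ _ _ _ p _ → p)) comp (v , u , v∈T , u∈C , adj-sym {G = G} e)
      in ℕ.<⇒≱ T<D (ℕ.≤-trans (wt-mono w D⊆C) (ι-cancel (subst₂ _≤ℚ_ (wt-ι w C) (wt-ι w T) le)))

  -- The threshold `α` lies between the components of `S` and the connected sets outside it, so `S`
  -- is safe. In 𝒢^cs a minimum connected safe set then weighs no more than `S`, and `safe⇒heaviest`
  -- makes it a set forbidden by `no-conn`.
  gcs-refute : InGcs G → (w : Fin n → ℕ) → (∀ v → 0 < w v) → ∀ α S → (∃ λ v → v ∈ S) →
    (∀ C → IsComponent G S C → α ≤ wtℕ w C) →
    (∀ D → ConnectedIn G D → D ⊆ complement S → wtℕ w D ≤ α) →
    (∀ T → ConnectedIn G T → (∀ D → ConnectedIn G D → D ⊆ complement T → ¬ wtℕ w T < wtℕ w D) →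
       ¬ wtℕ w T ≤ wtℕ w S) → ⊥
  gcs-refute gcs w pos α S nonempty heavy light no-conn =
    min-exists w (IsWSafe G (ι ∘ w)) {S} safeS λ (S₁ , safe₁ , min₁) →
    min-exists w (IsConnWSafe G (ι ∘ w)) {full} (full-safe _) λ (T , safeT , minT) →
      let eq = gcs (ι ∘ w) (λ v → positive (pos v)) _ _
                 ((S₁ , safe₁ , wt-ι w S₁) , λ X p → subst (_ ≤ℚ_) (≡-sym (wt-ι w X)) (ι-mono (min₁ X p)))
                 ((T , safeT , wt-ι w T) , λ X p → subst (_ ≤ℚ_) (≡-sym (wt-ι w X)) (ι-mono (minT X p)))
      in no-conn T (proj₂ safeT) (safe⇒heaviest w safeT)
           (ℕ.≤-trans (ι-cancel (ℚ.≤-reflexive (≡-sym eq))) (min₁ S safeS))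
    where
    positive : ∀ {k} → 0 < k → 0ℚ <ℚ ι k
    positive {suc k} _ = ι-pos k
    safeS : IsWSafe G (ι ∘ w) S
    safeS = nonempty , λ C D compC (D⊆ , connD , _) _ →
      subst₂ _≤ℚ_ (≡-sym (wt-ι w D)) (≡-sym (wt-ι w C))
        (ι-mono (ℕ.≤-trans (light D connD D⊆) (heavy C compC)))

-- Arithmetic helpers and the recognition of cycles

-- Naming the slack `d` turns an inequality into a polynomial identity, which the ring solver
-- proves.
<-by : ∀ {a b} d → suc a + d ≡ b → a < b
<-by {a} d eq = subst (a <_) eq (ℕ.m≤m+n (suc a) d)

≤-by : ∀ {a b} d → a + d ≡ b → a ≤ b
≤-by {a} d eq = subst (a ≤_) eq (ℕ.m≤m+n a d)

AtLeast : (Fin n → ℕ) → List (Fin n) → List ℕ → Set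
AtLeast w = Pointwise (λ v k → k ≤ w v)

sum-mono : ∀ {w : Fin n → ℕ} {l ks} → AtLeast w l ks → sum ks ≤ sum (map w l)
sum-mono [] = z≤n
sum-mono (k≤ ∷ ks≤) = ℕ.+-mono-≤ k≤ (sum-mono ks≤)

≡⇒≥ : ∀ {a b : ℕ} → a ≡ b → b ≤ a
≡⇒≥ e = ℕ.≤-reflexive (≡-sym e)

wt-single : ∀ (w : Fin n → ℕ) {X} a → (∀ {v} → v ∈ X → v ≡ a) → wtℕ w X ≤ w a
wt-single w {X} a only = subst (wtℕ w X ≤_)
  (trans (cong₂ _+_ (ℕ.+-identityʳ (w a)) (wt-∅ w)) (ℕ.+-identityʳ (w a)))
  (wt-upper w (a ∷ []) {Y = ∅} (λ v∈X → inj₁ (here (only v∈X))))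

nonempty⇒suc : ∀ (X : VSet n) {v} → v ∈ X → ∣ X ∣ ≡ suc (pred ∣ X ∣)
nonempty⇒suc X {v} v∈X with ∣ X ∣ | wt-lower′ (λ _ → 1) (v ∷ []) {X} ([] ∷ []) (v∈X ∷ [])
... | suc _ | _ = refl
... | zero  | ()

-- `IsCycle` indexes by the vertex count itself. Injections both ways between `Fin m` and `Fin n`
-- force `m` to equal `n`, so an enumeration of any length may be given.
cycle-intro : ∀ {n m} (G : Graph n) (f : Fin m → Fin n) → Injective _≡_ _≡_ f →
  (∀ v → ∃ λ i → f i ≡ v) → 3 ≤ m → (∀ i j → (adj G (f i) (f j) ≡ true) ⇔ CycAdj i j) → IsCycle G
cycle-intro G f inj surj 3≤m iff
  with refl ← ℕ.≤-antisym (Fin.injective⇒≤ inj)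
                (Fin.injective⇒≤ {f = proj₁ ∘ surj} λ {u} {v} e →
                  trans (≡-sym (proj₂ (surj u))) (trans (cong f e) (proj₂ (surj v))))
  = 3≤m , f , (inj , λ v → proj₁ (surj v) , λ { refl → proj₂ (surj v) }) , iff

-- Connected sets in the graph, and two ways to exclude a connected safe set

module Gcs {n} (G : Graph n) (triangle-free : TriangleFree G) (conn : Connected G) (gcs : InGcs G) where

  infix 4 _~_ _~?_

  _~_ : Fin n → Fin n → Set
  u ~ v = adj G u v ≡ true

  _~?_ : ∀ u v → Dec (u ~ v)
  u ~? v = adj G u v Bool.≟ true

  ~-sym : ∀ {u v} → u ~ v → v ~ u
  ~-sym = adj-sym {G = G}

  ~⇒≢ : ∀ {u v} → u ~ v → u ≢ v
  ~⇒≢ = adj⇒≢ {G = G}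

  grow-connected : ∀ {A D} → ConnectedIn G A → A ⊆ D →
    (∀ {d} → d ∈ D → d ∈ A ⊎ ∃ λ a → a ∈ A × a ~ d) → ConnectedIn G D
  grow-connected {A} {D} ((c , c∈A) , reach) A⊆D near = hub⇒connected {c = c} (A⊆D c c∈A) λ {d} d∈D →
    case near d∈D of λ where
      (inj₁ d∈A) → lift d∈A
      (inj₂ (a , a∈A , e)) → reach-trans (lift a∈A) (reach-edge (A⊆D a a∈A) d∈D e)
    where
    lift : ∀ {a} → a ∈ A → ReachIn G D c a
    lift {a} a∈A = _ , walk-mono A⊆D (proj₂ (reach c a c∈A a∈A))

  independent⇒single : ∀ {D d} → ConnectedIn G D → d ∈ D → (∀ {v} → v ∈ D → ¬ d ~ v) →
    ∀ {v} → v ∈ D → v ≡ d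
  independent⇒single {D} {d} connD d∈D indep {v} v∈D = decidable-stable (v ≟ d) λ v≢d →
    let x , x∈D , e = neighbour-in connD d∈D v∈D (≢-sym v≢d) in indep x∈D e

  -- A candidate `T` of weight at most `b` falls if listed vertices of it already exceed `b`, or if
  -- a connected set disjoint from it does. The list `ks` holds lower bounds for the listed weights,
  -- which leaves pure arithmetic.
  module Refute (w : Fin n → ℕ) {T : VSet n} (connT : ConnectedIn G T)
    (heaviest : ∀ D → ConnectedIn G D → D ⊆ complement T → ¬ wtℕ w T < wtℕ w D) where

    overweight : ∀ l {ks b} → wtℕ w T ≤ b → AtLeast w l ks → Unique l → All (_∈ T) l → b < sum ks → ⊥
    overweight l T≤b ks≤ uniq l⊆T b<ks =
      ℕ.<⇒≱ b<ks (ℕ.≤-trans (sum-mono ks≤) (ℕ.≤-trans (wt-lower′ w l uniq l⊆T) T≤b))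

    outweighed : ∀ l {ks b D} Y → wtℕ w T ≤ b → ConnectedIn G D → (∀ {v} → v ∈ D → ¬ v ∈ T) →
      AtLeast w l ks → Unique l → All (_∈ D) l → Y ⊆ D → All (λ v → ¬ v ∈ Y) l → b < sum ks + wtℕ w Y → ⊥
    outweighed l {D = D} Y T≤b connD D∩T ks≤ uniq l⊆D Y⊆D l∩Y b<ks =
      heaviest D connD (λ v v∈D → ∉⇒∈∁ T (D∩T v∈D))
        (ℕ.≤-<-trans T≤b (ℕ.<-≤-trans b<ks
          (ℕ.≤-trans (ℕ.+-monoˡ-≤ (wtℕ w Y) (sum-mono ks≤)) (wt-lower w l uniq l⊆D Y⊆D l∩Y))))

    outweighed′ : ∀ l {ks b D} → wtℕ w T ≤ b → ConnectedIn G D → (∀ {v} → v ∈ D → ¬ v ∈ T) →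
      AtLeast w l ks → Unique l → All (_∈ D) l → b < sum ks → ⊥
    outweighed′ l T≤b connD D∩T ks≤ uniq l⊆D b<ks =
      outweighed l ∅ T≤b connD D∩T ks≤ uniq l⊆D (λ _ ()) (All.universal (λ _ ()) l)
        (ℕ.<-≤-trans b<ks (ℕ.m≤m+n _ _))

    -- `i + (j + 0)` is the form to which `sum` of a two-element list computes.
    edge-outweighs : ∀ {u v i j b} → wtℕ w T ≤ b → u ~ v → ¬ u ∈ T → ¬ v ∈ T → w u ≡ i → w v ≡ j →
      b < i + (j + 0) → ⊥
    edge-outweighs {u} {v} T≤b u~v u∉T v∉T wu wv =
      outweighed′ (u ∷ v ∷ []) T≤b
        (star⇒connected (∈⁺ D? (inj₁ refl)) λ x∈D → case ∈⁻ D? x∈D of λ where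
          (inj₁ e) → inj₁ e
          (inj₂ refl) → inj₂ u~v)
        (λ x∈D → case ∈⁻ D? x∈D of λ where
          (inj₁ refl) → u∉T
          (inj₂ refl) → v∉T)
        (≡⇒≥ wu ∷ ≡⇒≥ wv ∷ []) ((~⇒≢ u~v ∷ []) ∷ [] ∷ []) (∈⁺ D? (inj₁ refl) ∷ ∈⁺ D? (inj₂ refl) ∷ [])
      where
      D? : ∀ x → Dec (x ≡ u ⊎ x ≡ v)
      D? x = (x ≟ u) ⊎-dec (x ≟ v)

    cherry-outweighs : ∀ {c u v h i j b} → wtℕ w T ≤ b → c ~ u → c ~ v → u ≢ v → ¬ c ∈ T → ¬ u ∈ T → ¬ v ∈ T →
      w c ≡ h → w u ≡ i → w v ≡ j → b < h + (i + (j + 0)) → ⊥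
    cherry-outweighs {c} {u} {v} T≤b c~u c~v u≢v c∉T u∉T v∉T wc wu wv =
      outweighed′ (c ∷ u ∷ v ∷ []) T≤b
        (star⇒connected (∈⁺ D? (inj₁ refl)) λ x∈D → case ∈⁻ D? x∈D of λ where
          (inj₁ e) → inj₁ e
          (inj₂ (inj₁ refl)) → inj₂ c~u
          (inj₂ (inj₂ refl)) → inj₂ c~v)
        (λ x∈D → case ∈⁻ D? x∈D of λ where
          (inj₁ refl) → c∉T
          (inj₂ (inj₁ refl)) → u∉T
          (inj₂ (inj₂ refl)) → v∉T)
        (≡⇒≥ wc ∷ ≡⇒≥ wu ∷ ≡⇒≥ wv ∷ []) ((~⇒≢ c~u ∷ ~⇒≢ c~v ∷ []) ∷ (u≢v ∷ []) ∷ [] ∷ [])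
        (∈⁺ D? (inj₁ refl) ∷ ∈⁺ D? (inj₂ (inj₁ refl)) ∷ ∈⁺ D? (inj₂ (inj₂ refl)) ∷ [])
      where
      D? : ∀ x → Dec (x ≡ c ⊎ x ≡ u ⊎ x ≡ v)
      D? x = (x ≟ c) ⊎-dec (x ≟ u) ⊎-dec (x ≟ v)

  -- Nice vertices have exactly two neighbours

  apart? : ∀ x v → Dec (v ≢ x × ¬ x ~ v)
  apart? x v = ¬? (v ≟ x) ×-dec ¬? (x ~? v)

  H : Fin n → VSet n
  H x = ⟦ apart? x ⟧

  ∈H⁺ : ∀ {x v} → v ≢ x → ¬ x ~ v → v ∈ H x
  ∈H⁺ {x} v≢x x≁v = ∈⁺ (apart? x) (v≢x , x≁v)

  ∈H⁻ : ∀ {x v} → v ∈ H x → v ≢ x × ¬ x ~ v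
  ∈H⁻ {x} = ∈⁻ (apart? x)

  trichotomy : ∀ x v → v ≡ x ⊎ x ~ v ⊎ v ∈ H x
  trichotomy x v with v ≟ x | x ~? v
  ... | yes e | _     = inj₁ e
  ... | no _  | yes e = inj₂ (inj₁ e)
  ... | no v≢ | no x≁ = inj₂ (inj₂ (∈H⁺ v≢ x≁))

  record Nice (x : Fin n) : Set where
    field
      H-connected : ConnectedIn G (H x)
      into-H : ∀ {p} → x ~ p → ∃ λ h → h ∈ H x × p ~ h
      q₁ q₂ : Fin n
      x~q₁ : x ~ q₁
      x~q₂ : x ~ q₂
      q₁≢q₂ : q₁ ≢ q₂

  -- Pigeonhole: two of three vertices fall on the same side of `A`. `Q` carries what is known about
  -- the chosen pair.
  two-of-three : ∀ (A : VSet n) p q r (Q : Fin n → Fin n → Set) →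
    Q p q → Q p r → Q q r →
    (∃ λ a → ∃ λ b → Q a b × a ∈ A × b ∈ A) ⊎ (∃ λ a → ∃ λ b → Q a b × ¬ a ∈ A × ¬ b ∈ A)
  two-of-three A p q r Q pq pr qr with p ∈? A | q ∈? A | r ∈? A
  ... | yes a | yes b | _     = inj₁ (p , q , pq , a , b)
  ... | yes a | no b  | yes c = inj₁ (p , r , pr , a , c)
  ... | yes a | no b  | no c  = inj₂ (q , r , qr , b , c)
  ... | no a  | no b  | _     = inj₂ (p , q , pq , a , b)
  ... | no a  | yes b | yes c = inj₁ (q , r , qr , b , c)
  ... | no a  | yes b | no c  = inj₂ (p , r , pr , a , c)

  -- Weights: 4|H| on x, 4 on each vertex of H, 4|H| − 1 on each neighbour of x.
  -- Then {x} ∪ H is safe, but a connected set of at most that weight leaves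
  -- two neighbours of x joined through x or through H.
  module DegreeThree {x} (nice : Nice x) {p q r} (x~p : x ~ p) (x~q : x ~ q) (x~r : x ~ r)
    (p≢q : p ≢ q) (p≢r : p ≢ r) (q≢r : q ≢ r) where
    open Nice nice

    -- With |H| written as 1 + m, the weights 4|H| and 4|H| - 1 become `4 + 4 * m` and `3 + 4 * m`,
    -- free of truncated subtraction.
    m : ℕ
    m = pred ∣ H x ∣

    w : Fin n → ℕ
    w v = if does (v ≟ x) then 4 + 4 * m else if does (x ~? v) then 3 + 4 * m else 4

    w-x : w x ≡ 4 + 4 * m
    w-x rewrite dec-true (x ≟ x) refl = refl

    w-nbr : ∀ {v} → x ~ v → w v ≡ 3 + 4 * m
    w-nbr {v} e rewrite dec-false (v ≟ x) (≢-sym (~⇒≢ e)) | dec-true (x ~? v) e = refl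

    w-H : ∀ {v} → v ∈ H x → w v ≡ 4
    w-H {v} v∈H rewrite dec-false (v ≟ x) (proj₁ (∈H⁻ v∈H)) | dec-false (x ~? v) (proj₂ (∈H⁻ v∈H)) = refl

    w-pos : ∀ v → 0 < w v
    w-pos v with trichotomy x v
    ... | inj₁ refl rewrite w-x = s≤s z≤n
    ... | inj₂ (inj₁ e) rewrite w-nbr e = s≤s z≤n
    ... | inj₂ (inj₂ v∈H) rewrite w-H v∈H = s≤s z≤n

    wt-H : wtℕ w (H x) ≡ 4 * suc m
    wt-H = trans (wt-const w 4 w-H) (cong (4 *_) (nonempty⇒suc (H x) (proj₂ (proj₁ H-connected))))

    S? : ∀ v → Dec (v ≡ x ⊎ v ∈ H x)
    S? v = (v ≟ x) ⊎-dec (v ∈? H x)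

    S-weight : wtℕ w ⟦ S? ⟧ ≤ 8 + 8 * m
    S-weight = ℕ.≤-trans (wt-upper w (x ∷ []) λ v∈S → case ∈⁻ S? v∈S of λ where
        (inj₁ e) → inj₁ (here e)
        (inj₂ v∈H) → inj₂ v∈H)
      (ℕ.≤-reflexive (trans (cong₂ (λ a b → a + 0 + b) w-x wt-H) (arith m)))
      where
      arith : ∀ m → 4 + 4 * m + 0 + 4 * suc m ≡ 8 + 8 * m
      arith = solve-∀

    S-heavy : ∀ C → IsComponent G ⟦ S? ⟧ C → 4 + 4 * m ≤ wtℕ w C
    S-heavy C (C⊆S , ((c , c∈C) , _) , closed) with ∈⁻ S? (C⊆S c c∈C)
    ... | inj₁ refl = subst (_≤ wtℕ w C) (trans (ℕ.+-identityʳ _) w-x) (wt-lower′ w (x ∷ []) {C} ([] ∷ []) (c∈C ∷ []))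
    ... | inj₂ c∈H = subst (_≤ wtℕ w C) (trans wt-H (ℕ.*-suc 4 m)) (wt-mono w λ v v∈H →
            connected-transport (_∈ C) H-connected
              (λ _ y∈H e u∈C → closed _ _ u∈C (∈⁺ S? (inj₂ y∈H)) e) c∈H v∈H c∈C)

    -- By triangle-freeness the neighbours of `x` are independent, so a connected `D` among them is
    -- a single vertex.
    S-light : ∀ D → ConnectedIn G D → D ⊆ complement ⟦ S? ⟧ → wtℕ w D ≤ 4 + 4 * m
    S-light D connD@((d , d∈D) , _) D⊆ =
      ℕ.≤-trans (wt-single w d (independent⇒single connD d∈D λ v∈D e →
                   triangle-free _ _ _ (nbr d∈D) e (nbr v∈D)))
        (ℕ.≤-trans (ℕ.≤-reflexive (w-nbr (nbr d∈D))) (ℕ.n≤1+n _))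
      where
      nbr : ∀ {v} → v ∈ D → x ~ v
      nbr {v} v∈D with trichotomy x v
      ... | inj₁ e = contradiction (∈⁺ S? (inj₁ e)) (∈∁⇒∉ ⟦ S? ⟧ (D⊆ v v∈D))
      ... | inj₂ (inj₁ e) = e
      ... | inj₂ (inj₂ v∈H) = contradiction (∈⁺ S? (inj₂ v∈H)) (∈∁⇒∉ ⟦ S? ⟧ (D⊆ v v∈D))

    Pair : Fin n → Fin n → Set
    Pair a b = x ~ a × x ~ b × a ≢ b

    no-connected : ∀ T → ConnectedIn G T →
      (∀ D → ConnectedIn G D → D ⊆ complement T → ¬ wtℕ w T < wtℕ w D) → ¬ wtℕ w T ≤ wtℕ w ⟦ S? ⟧
    no-connected T connT heaviest T≤S
      with two-of-three T p q r Pair (x~p , x~q , p≢q) (x~p , x~r , p≢r) (x~q , x~r , q≢r)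
         | x ∈? T | sub? (H x) (complement T)
    ... | inj₁ (a , b , (x~a , x~b , a≢b) , a∈T , b∈T) | yes x∈T | _ =
      overweight (x ∷ a ∷ b ∷ []) (ℕ.≤-trans T≤S S-weight)
        (≡⇒≥ w-x ∷ ≡⇒≥ (w-nbr x~a) ∷ ≡⇒≥ (w-nbr x~b) ∷ [])
        ((~⇒≢ x~a ∷ ~⇒≢ x~b ∷ []) ∷ (a≢b ∷ []) ∷ [] ∷ []) (x∈T ∷ a∈T ∷ b∈T ∷ [])
        (<-by (1 + 4 * m) (arith m))
      where
      open Refute w connT heaviest
      arith : ∀ m → suc (8 + 8 * m) + (1 + 4 * m) ≡ (4 + 4 * m) + ((3 + 4 * m) + ((3 + 4 * m) + 0))
      arith = solve-∀
    -- Without `x`, connectedness gives `a` a neighbour `h` in `T`; it lies in `H x`, since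
    -- neighbours of `x` are independent. Then `a`, `b`, `h` weigh 10 + 8m against 8 + 8m.
    ... | inj₁ (a , b , (x~a , x~b , a≢b) , a∈T , b∈T) | no x∉T | _
      with h , h∈T , a~h ← neighbour-in connT a∈T b∈T a≢b
      with trichotomy x h
    ...   | inj₁ refl = x∉T h∈T
    ...   | inj₂ (inj₁ x~h) = triangle-free _ _ _ x~a a~h x~h
    ...   | inj₂ (inj₂ h∈H) =
      overweight (a ∷ b ∷ h ∷ []) (ℕ.≤-trans T≤S S-weight)
        (≡⇒≥ (w-nbr x~a) ∷ ≡⇒≥ (w-nbr x~b) ∷ ≡⇒≥ (w-H h∈H) ∷ [])
        ((a≢b ∷ ~⇒≢ a~h ∷ []) ∷ ((λ { refl → proj₂ (∈H⁻ h∈H) x~b }) ∷ []) ∷ [] ∷ []) (a∈T ∷ b∈T ∷ h∈T ∷ [])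
        (<-by 1 (arith m))
      where
      open Refute w connT heaviest
      arith : ∀ m → suc (8 + 8 * m) + 1 ≡ (3 + 4 * m) + ((3 + 4 * m) + (4 + 0))
      arith = solve-∀
    no-connected T connT heaviest T≤S
        | inj₂ (a , b , (x~a , x~b , a≢b) , a∉T , b∉T) | no x∉T | _ =
      cherry-outweighs (ℕ.≤-trans T≤S S-weight) x~a x~b a≢b x∉T a∉T b∉T w-x (w-nbr x~a) (w-nbr x~b)
        (<-by (1 + 4 * m) (arith m))
      where
      open Refute w connT heaviest
      arith : ∀ m → suc (8 + 8 * m) + (1 + 4 * m) ≡ (4 + 4 * m) + ((3 + 4 * m) + ((3 + 4 * m) + 0))
      arith = solve-∀
    -- Containing both `x` and a vertex of `H x`, a connected `T` also contains a neighbour of `x`.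
    no-connected T connT heaviest T≤S
     | inj₂ _ | yes x∈T | inj₁ (h , h∈H , h∉∁T)
      with c , c∈T , x~c ← neighbour-in connT x∈T (decidable-stable (h ∈? T) λ h∉T → h∉∁T (∉⇒∈∁ T h∉T))
                             (≢-sym (proj₁ (∈H⁻ h∈H))) =
      overweight (x ∷ c ∷ h ∷ []) (ℕ.≤-trans T≤S S-weight)
        (≡⇒≥ w-x ∷ ≡⇒≥ (w-nbr x~c) ∷ ≡⇒≥ (w-H h∈H) ∷ [])
        ((~⇒≢ x~c ∷ ≢-sym (proj₁ (∈H⁻ h∈H)) ∷ []) ∷ ((λ { refl → proj₂ (∈H⁻ h∈H) x~c }) ∷ []) ∷ [] ∷ [])
        (x∈T ∷ c∈T ∷ decidable-stable (h ∈? T) (λ h∉T → h∉∁T (∉⇒∈∁ T h∉T)) ∷ [])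
        (<-by 2 (arith m))
      where
      open Refute w connT heaviest
      arith : ∀ m → suc (8 + 8 * m) + 2 ≡ (4 + 4 * m) + ((3 + 4 * m) + (4 + 0))
      arith = solve-∀
    -- Now `T` avoids `H x`, and `a`, `b` attach to `H x` through `into-H`: one connected competitor
    -- outside `T`.
    no-connected T connT heaviest T≤S
     | inj₂ (a , b , (x~a , x~b , a≢b) , a∉T , b∉T) | yes x∈T | inj₂ H⊆∁T =
      outweighed (a ∷ b ∷ []) (H x) (ℕ.≤-trans T≤S S-weight)
        (grow-connected H-connected (λ v v∈H → ∈⁺ D? (inj₂ (inj₂ v∈H))) λ v∈D → case ∈⁻ D? v∈D of λ where
          (inj₁ refl) → inj₂ (via x~a)
          (inj₂ (inj₁ refl)) → inj₂ (via x~b)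
          (inj₂ (inj₂ v∈H)) → inj₁ v∈H)
        (λ v∈D → case ∈⁻ D? v∈D of λ where
          (inj₁ refl) → a∉T
          (inj₂ (inj₁ refl)) → b∉T
          (inj₂ (inj₂ v∈H)) → ∈∁⇒∉ T (H⊆∁T _ v∈H))
        (≡⇒≥ (w-nbr x~a) ∷ ≡⇒≥ (w-nbr x~b) ∷ [])
        ((a≢b ∷ []) ∷ [] ∷ [])
        (∈⁺ D? (inj₁ refl) ∷ ∈⁺ D? (inj₂ (inj₁ refl)) ∷ [])
        (λ v v∈H → ∈⁺ D? (inj₂ (inj₂ v∈H)))
        ((λ a∈H → proj₂ (∈H⁻ a∈H) x~a) ∷ (λ b∈H → proj₂ (∈H⁻ b∈H) x~b) ∷ [])
        (subst (λ k → 8 + 8 * m < (3 + 4 * m) + ((3 + 4 * m) + 0) + k) (≡-sym wt-H) (<-by (1 + 4 * m) (arith m)))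
      where
      open Refute w connT heaviest
      D? : ∀ v → Dec (v ≡ a ⊎ v ≡ b ⊎ v ∈ H x)
      D? v = (v ≟ a) ⊎-dec (v ≟ b) ⊎-dec (v ∈? H x)
      via : ∀ {c} → x ~ c → ∃ λ h → h ∈ H x × h ~ c
      via x~c = let h , h∈H , c~h = into-H x~c in h , h∈H , ~-sym c~h
      arith : ∀ m → suc (8 + 8 * m) + (1 + 4 * m) ≡ (3 + 4 * m) + ((3 + 4 * m) + 0) + 4 * suc m
      arith = solve-∀

    impossible : ⊥
    impossible = gcs-refute conn gcs w w-pos (4 + 4 * m) ⟦ S? ⟧ (x , ∈⁺ S? (inj₁ refl))
      S-heavy S-light no-connected

  open Nice

  nice⇒degree-2 : ∀ {x} (nice : Nice x) {r} → x ~ r → r ≡ q₁ nice ⊎ r ≡ q₂ nice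
  nice⇒degree-2 {x} nice {r} x~r with r ≟ q₁ nice | r ≟ q₂ nice
  ... | yes e | _ = inj₁ e
  ... | no _ | yes e = inj₂ e
  ... | no r≢q₁ | no r≢q₂ = ⊥-elim (DegreeThree.impossible nice (x~q₁ nice) (x~q₂ nice) x~r
                              (q₁≢q₂ nice) (≢-sym r≢q₁) (≢-sym r≢q₂))

  -- Vertices of `H y` whose removal keeps it connected

  -- Weights: 8k + 1 on y, 8 on each vertex of K = H y ∖ t, where k = |K|, and
  -- 8k − 1 on t and on the neighbours of y; the safe set is K ∪ {y}.
  module Removable {y} (nice : Nice y) {t} (t∈H : t ∈ H y)
    (q₁≁t : ¬ q₁ nice ~ t) (q₂≁t : ¬ q₂ nice ~ t) (K-connected : ConnectedIn G (H y ∖ t)) where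

    K : VSet n
    K = H y ∖ t

    ∈K⁻ : ∀ {v} → v ∈ K → v ∈ H y × v ≢ t
    ∈K⁻ = ∈∖⁻ (H y)

    y~⇒∉K : ∀ {v} → y ~ v → ¬ v ∈ K
    y~⇒∉K y~v v∈K = proj₂ (∈H⁻ (proj₁ (∈K⁻ v∈K))) y~v

    ∈K⇒≢y : ∀ {v} → v ∈ K → v ≢ y
    ∈K⇒≢y v∈K = proj₁ (∈H⁻ (proj₁ (∈K⁻ v∈K)))

    t∉K : ¬ t ∈ K
    t∉K t∈K = proj₂ (∈K⁻ t∈K) refl

    nbr≁t : ∀ {q} → y ~ q → ¬ q ~ t
    nbr≁t y~q q~t with nice⇒degree-2 nice y~q
    ... | inj₁ refl = q₁≁t q~t
    ... | inj₂ refl = q₂≁t q~t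

    nbr≢t : ∀ {q} → y ~ q → q ≢ t
    nbr≢t y~q refl = proj₂ (∈H⁻ t∈H) y~q

    nbr-into-K : ∀ {q} → y ~ q → ∃ λ h → h ∈ K × h ~ q
    nbr-into-K y~q with h , h∈H , q~h ← into-H nice y~q =
      h , ∈∖⁺ (H y) h∈H (λ { refl → nbr≁t y~q q~h }) , ~-sym q~h

    t-into-K : ∃ λ h → h ∈ K × h ~ t
    t-into-K with h , h∈H , t~h ← neighbour-in (H-connected nice) t∈H
                    (proj₁ (∈K⁻ (proj₂ (proj₁ K-connected)))) (≢-sym (proj₂ (∈K⁻ (proj₂ (proj₁ K-connected))))) =
      h , ∈∖⁺ (H y) h∈H (≢-sym (~⇒≢ t~h)) , ~-sym t~h

    data Class (v : Fin n) : Set where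
      is-y  : v ≡ y → Class v
      is-t  : v ≡ t → Class v
      nbr   : y ~ v → Class v
      in-K  : v ∈ K → Class v

    classify : ∀ v → Class v
    classify v with trichotomy y v | v ≟ t
    ... | inj₁ e          | _      = is-y e
    ... | inj₂ (inj₁ y~v) | _      = nbr y~v
    ... | inj₂ (inj₂ _)   | yes e  = is-t e
    ... | inj₂ (inj₂ v∈H) | no v≢t = in-K (∈∖⁺ (H y) v∈H v≢t)

    -- With k = 1 + m, the weights 8k + 1 and 8k - 1 are `9 + 8 * m` and `7 + 8 * m`; the threshold
    -- is 8k and the safe set weighs 16k + 1.
    m : ℕ
    m = pred ∣ K ∣

    w : Fin n → ℕ
    w v = if does (v ≟ y) then 9 + 8 * m else if does (v ∈? K) then 8 else 7 + 8 * m

    w-y : w y ≡ 9 + 8 * m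
    w-y rewrite dec-true (y ≟ y) refl = refl

    w-K : ∀ {v} → v ∈ K → w v ≡ 8
    w-K {v} v∈K rewrite dec-false (v ≟ y) (∈K⇒≢y v∈K) | dec-true (v ∈? K) v∈K = refl

    w-nbr : ∀ {v} → y ~ v → w v ≡ 7 + 8 * m
    w-nbr {v} y~v rewrite dec-false (v ≟ y) (≢-sym (~⇒≢ y~v)) | dec-false (v ∈? K) (y~⇒∉K y~v) = refl

    w-t : w t ≡ 7 + 8 * m
    w-t rewrite dec-false (t ≟ y) (proj₁ (∈H⁻ t∈H)) | dec-false (t ∈? K) t∉K = refl

    w-pos : ∀ v → 0 < w v
    w-pos v with classify v
    ... | is-y refl rewrite w-y     = s≤s z≤n
    ... | is-t refl rewrite w-t     = s≤s z≤n
    ... | nbr y~v rewrite w-nbr y~v = s≤s z≤n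
    ... | in-K v∈K rewrite w-K v∈K  = s≤s z≤n

    wt-K : wtℕ w K ≡ 8 * suc m
    wt-K = trans (wt-const w 8 w-K) (cong (8 *_) (nonempty⇒suc K (proj₂ (proj₁ K-connected))))

    S? : ∀ v → Dec (v ≡ y ⊎ v ∈ K)
    S? v = (v ≟ y) ⊎-dec (v ∈? K)

    S-weight : wtℕ w ⟦ S? ⟧ ≤ 17 + 16 * m
    S-weight = ℕ.≤-trans (wt-upper w (y ∷ []) λ v∈S → case ∈⁻ S? v∈S of λ where
        (inj₁ e) → inj₁ (here e)
        (inj₂ v∈K) → inj₂ v∈K)
      (ℕ.≤-reflexive (trans (cong₂ (λ a b → a + 0 + b) w-y wt-K) (arith m)))
      where
      arith : ∀ m → 9 + 8 * m + 0 + 8 * suc m ≡ 17 + 16 * m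
      arith = solve-∀

    S-heavy : ∀ C → IsComponent G ⟦ S? ⟧ C → 8 + 8 * m ≤ wtℕ w C
    S-heavy C (C⊆S , ((c , c∈C) , _) , closed) with ∈⁻ S? (C⊆S c c∈C)
    ... | inj₁ refl = ℕ.≤-trans (ℕ.n≤1+n _)
            (subst (_≤ wtℕ w C) (trans (ℕ.+-identityʳ _) w-y) (wt-lower′ w (y ∷ []) {C} ([] ∷ []) (c∈C ∷ [])))
    ... | inj₂ c∈K = subst (_≤ wtℕ w C) (trans wt-K (ℕ.*-suc 8 m)) (wt-mono w λ v v∈K →
            connected-transport (_∈ C) K-connected
              (λ _ z∈K e u∈C → closed _ _ u∈C (∈⁺ S? (inj₂ z∈K)) e) c∈K v∈K c∈C)

    -- `t` is adjacent to no neighbour of `y`, and those are mutually non-adjacent, so outside the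
    -- safe set only single vertices of weight 8k - 1 are connected.
    S-light : ∀ D → ConnectedIn G D → D ⊆ complement ⟦ S? ⟧ → wtℕ w D ≤ 8 + 8 * m
    S-light D connD@((d , d∈D) , _) D⊆ =
      ℕ.≤-trans (wt-single w d (independent⇒single connD d∈D λ v∈D → indep (outside d∈D) (outside v∈D)))
        (ℕ.≤-trans (ℕ.≤-reflexive (weight (outside d∈D))) (ℕ.n≤1+n _))
      where
      outside : ∀ {v} → v ∈ D → v ≡ t ⊎ y ~ v
      outside {v} v∈D with classify v
      ... | is-y e    = contradiction (∈⁺ S? (inj₁ e)) (∈∁⇒∉ ⟦ S? ⟧ (D⊆ v v∈D))
      ... | is-t e    = inj₁ e
      ... | nbr y~v   = inj₂ y~v
      ... | in-K v∈K  = contradiction (∈⁺ S? (inj₂ v∈K)) (∈∁⇒∉ ⟦ S? ⟧ (D⊆ v v∈D))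
      indep : ∀ {u v} → u ≡ t ⊎ y ~ u → v ≡ t ⊎ y ~ v → ¬ u ~ v
      indep (inj₁ refl) (inj₁ refl) e = ~⇒≢ e refl
      indep (inj₁ refl) (inj₂ y~v) e = nbr≁t y~v (~-sym e)
      indep (inj₂ y~u) (inj₁ refl) e = nbr≁t y~u e
      indep (inj₂ y~u) (inj₂ y~v) e = triangle-free _ _ _ y~u e y~v
      weight : ∀ {u} → u ≡ t ⊎ y ~ u → w u ≡ 7 + 8 * m
      weight (inj₁ refl) = w-t
      weight (inj₂ y~u)  = w-nbr y~u

    module _ {T} (connT : ConnectedIn G T)
      (heaviest : ∀ D → ConnectedIn G D → D ⊆ complement T → ¬ wtℕ w T < wtℕ w D)
      (T≤S : wtℕ w T ≤ wtℕ w ⟦ S? ⟧) where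
      open Refute w connT heaviest

      T≤ : wtℕ w T ≤ 17 + 16 * m
      T≤ = ℕ.≤-trans T≤S S-weight

      no-y-K : ∀ {u} → y ∈ T → u ∈ T → ¬ u ∈ K
      no-y-K y∈T u∈T u∈K with q , q∈T , y~q ← neighbour-in connT y∈T u∈T (≢-sym (∈K⇒≢y u∈K)) =
        overweight (y ∷ q ∷ _ ∷ []) T≤ (≡⇒≥ w-y ∷ ≡⇒≥ (w-nbr y~q) ∷ ≡⇒≥ (w-K u∈K) ∷ [])
          ((~⇒≢ y~q ∷ ≢-sym (∈K⇒≢y u∈K) ∷ []) ∷ ((λ { refl → y~⇒∉K y~q u∈K }) ∷ []) ∷ [] ∷ [])
          (y∈T ∷ q∈T ∷ u∈T ∷ []) (<-by 6 (arith m))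
        where
        arith : ∀ m → suc (17 + 16 * m) + 6 ≡ (9 + 8 * m) + ((7 + 8 * m) + (8 + 0))
        arith = solve-∀

      no-y-t : y ∈ T → ¬ t ∈ T
      no-y-t y∈T t∈T with q , q∈T , y~q ← neighbour-in connT y∈T t∈T (≢-sym (proj₁ (∈H⁻ t∈H))) =
        overweight (y ∷ q ∷ t ∷ []) T≤ (≡⇒≥ w-y ∷ ≡⇒≥ (w-nbr y~q) ∷ ≡⇒≥ w-t ∷ [])
          ((~⇒≢ y~q ∷ ≢-sym (proj₁ (∈H⁻ t∈H)) ∷ []) ∷ (nbr≢t y~q ∷ []) ∷ [] ∷ [])
          (y∈T ∷ q∈T ∷ t∈T ∷ []) (<-by (5 + 8 * m) (arith m))
        where
        arith : ∀ m → suc (17 + 16 * m) + (5 + 8 * m) ≡ (9 + 8 * m) + ((7 + 8 * m) + ((7 + 8 * m) + 0))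
        arith = solve-∀

      -- `no-y-K` and `no-y-t` keep `K` and `t` out of `T`, so `K` together with `t` and `q` is a
      -- connected competitor of weight 24k - 2.
      no-y-alone : ∀ {q} → y ~ q → y ∈ T → ¬ ¬ q ∈ T
      no-y-alone {q} y~q y∈T q∉T =
        outweighed (t ∷ q ∷ []) K T≤
          (grow-connected K-connected (λ v v∈K → ∈⁺ D? (inj₂ (inj₂ v∈K))) λ v∈D → case ∈⁻ D? v∈D of λ where
            (inj₁ refl) → inj₂ t-into-K
            (inj₂ (inj₁ refl)) → inj₂ (nbr-into-K y~q)
            (inj₂ (inj₂ v∈K)) → inj₁ v∈K)
          (λ v∈D → case ∈⁻ D? v∈D of λ where
            (inj₁ refl) → no-y-t y∈T
            (inj₂ (inj₁ refl)) → q∉T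
            (inj₂ (inj₂ v∈K)) v∈T → no-y-K y∈T v∈T v∈K)
          (≡⇒≥ w-t ∷ ≡⇒≥ (w-nbr y~q) ∷ []) ((≢-sym (nbr≢t y~q) ∷ []) ∷ [] ∷ [])
          (∈⁺ D? (inj₁ refl) ∷ ∈⁺ D? (inj₂ (inj₁ refl)) ∷ [])
          (λ v v∈K → ∈⁺ D? (inj₂ (inj₂ v∈K)))
          (t∉K ∷ y~⇒∉K y~q ∷ [])
          (subst (λ k → 17 + 16 * m < (7 + 8 * m) + ((7 + 8 * m) + 0) + k) (≡-sym wt-K) (<-by (4 + 8 * m) (arith m)))
        where
        D? : ∀ v → Dec (v ≡ t ⊎ v ≡ q ⊎ v ∈ K)
        D? v = (v ≟ t) ⊎-dec (v ≟ q) ⊎-dec (v ∈? K)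
        arith : ∀ m → suc (17 + 16 * m) + (4 + 8 * m) ≡ (7 + 8 * m) + ((7 + 8 * m) + 0) + 8 * suc m
        arith = solve-∀

      no-y : ¬ y ∈ T
      no-y y∈T = no-y-alone (x~q₁ nice) y∈T λ q₁∈T → no-y-alone (x~q₂ nice) y∈T λ q₂∈T →
        overweight (y ∷ q₁ nice ∷ q₂ nice ∷ []) T≤
          (≡⇒≥ w-y ∷ ≡⇒≥ (w-nbr (x~q₁ nice)) ∷ ≡⇒≥ (w-nbr (x~q₂ nice)) ∷ [])
          ((~⇒≢ (x~q₁ nice) ∷ ~⇒≢ (x~q₂ nice) ∷ []) ∷ (q₁≢q₂ nice ∷ []) ∷ [] ∷ [])
          (y∈T ∷ q₁∈T ∷ q₂∈T ∷ []) (<-by (5 + 8 * m) (arith m))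
        where
        arith : ∀ m → suc (17 + 16 * m) + (5 + 8 * m) ≡ (9 + 8 * m) + ((7 + 8 * m) + ((7 + 8 * m) + 0))
        arith = solve-∀

      -- Here T has weight at least that of {y, q′}, i.e. 16 + 16 m.
      no-one : ∀ {q q′} → y ~ q → y ~ q′ → (∀ {v} → y ~ v → v ≡ q ⊎ v ≡ q′) → q ∈ T → ¬ ¬ q′ ∈ T
      no-one {q} {q′} y~q y~q′ only q∈T q′∉T with t ∈? T | sub? T (complement K)
      -- `T` lies in `K` together with `q`, of weight 16k - 1, while `y` and `q′` weigh 16k: the
      -- extra 1 on `y` makes this strict.
      ... | no t∉T | _ =
        edge-outweighs (wt-upper w (q ∷ []) cover) y~q′ no-y q′∉T w-y (w-nbr y~q′)
          (subst (_< (9 + 8 * m) + ((7 + 8 * m) + 0)) (≡-sym (cong₂ (λ a b → a + 0 + b) (w-nbr y~q) wt-K))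
            (<-by 0 (arith m)))
        where
        cover : ∀ {v} → v ∈ T → v List.∈ (q ∷ []) ⊎ v ∈ K
        cover {v} v∈T with classify v
        ... | is-y refl = contradiction v∈T no-y
        ... | is-t refl = contradiction v∈T t∉T
        ... | in-K v∈K  = inj₂ v∈K
        ... | nbr y~v with only y~v
        ...   | inj₁ e = inj₁ (here e)
        ...   | inj₂ refl = contradiction v∈T q′∉T
        arith : ∀ m → suc ((7 + 8 * m) + 0 + 8 * suc m) + 0 ≡ (9 + 8 * m) + ((7 + 8 * m) + 0)
        arith = solve-∀
      ... | yes t∈T | inj₁ (u , u∈T , u∉∁K) =
        overweight (q ∷ t ∷ u ∷ []) T≤ (≡⇒≥ (w-nbr y~q) ∷ ≡⇒≥ w-t ∷ ≡⇒≥ (w-K u∈K) ∷ [])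
          ((nbr≢t y~q ∷ (λ { refl → y~⇒∉K y~q u∈K }) ∷ []) ∷ ((λ { refl → t∉K u∈K }) ∷ []) ∷ [] ∷ [])
          (q∈T ∷ t∈T ∷ u∈T ∷ []) (<-by 4 (arith m))
        where
        u∈K : u ∈ K
        u∈K = decidable-stable (u ∈? K) λ u∉K → u∉∁K (∉⇒∈∁ K u∉K)
        arith : ∀ m → suc (17 + 16 * m) + 4 ≡ (7 + 8 * m) + ((7 + 8 * m) + (8 + 0))
        arith = solve-∀
      ... | yes t∈T | inj₂ T⊆∁K =
        edge-outweighs (wt-upper w (q ∷ t ∷ []) {Y = ∅} cover) y~q′ no-y q′∉T w-y (w-nbr y~q′)
          (subst (_< (9 + 8 * m) + ((7 + 8 * m) + 0))
            (≡-sym (cong₂ _+_ (cong₂ (λ a b → a + (b + 0)) (w-nbr y~q) w-t) (wt-∅ w)))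
            (<-by 1 (arith m)))
        where
        cover : ∀ {v} → v ∈ T → v List.∈ (q ∷ t ∷ []) ⊎ v ∈ ∅
        cover {v} v∈T with classify v
        ... | is-y refl = contradiction v∈T no-y
        ... | is-t e = inj₁ (there (here e))
        ... | in-K v∈K  = contradiction v∈K (∈∁⇒∉ K (T⊆∁K v v∈T))
        ... | nbr y~v with only y~v
        ...   | inj₁ e = inj₁ (here e)
        ...   | inj₂ refl = contradiction v∈T q′∉T
        arith : ∀ m → suc ((7 + 8 * m) + ((7 + 8 * m) + 0) + 0) + 1 ≡ (9 + 8 * m) + ((7 + 8 * m) + 0)
        arith = solve-∀

      -- A neighbour of `q₁ nice` in `T` can be neither `y` nor `t` nor a neighbour of `y`, so it
      -- lies in `K`, and the three weights exceed 16k + 1.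
      no-two : q₁ nice ∈ T → ¬ q₂ nice ∈ T
      no-two q₁∈T q₂∈T with v , v∈T , q₁~v ← neighbour-in connT q₁∈T q₂∈T (q₁≢q₂ nice) with classify v
      ... | is-y refl = no-y v∈T
      ... | is-t refl = q₁≁t q₁~v
      ... | nbr y~v = triangle-free _ _ _ (x~q₁ nice) q₁~v y~v
      ... | in-K v∈K =
        overweight (q₁ nice ∷ q₂ nice ∷ v ∷ []) T≤
          (≡⇒≥ (w-nbr (x~q₁ nice)) ∷ ≡⇒≥ (w-nbr (x~q₂ nice)) ∷ ≡⇒≥ (w-K v∈K) ∷ [])
          ((q₁≢q₂ nice ∷ ~⇒≢ q₁~v ∷ []) ∷ ((λ { refl → y~⇒∉K (x~q₂ nice) v∈K }) ∷ []) ∷ [] ∷ [])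
          (q₁∈T ∷ q₂∈T ∷ v∈T ∷ []) (<-by 4 (arith m))
        where
        arith : ∀ m → suc (17 + 16 * m) + 4 ≡ (7 + 8 * m) + ((7 + 8 * m) + (8 + 0))
        arith = solve-∀

      no-T : ⊥
      no-T with q₁ nice ∈? T | q₂ nice ∈? T
      ... | yes q₁∈T | yes q₂∈T = no-two q₁∈T q₂∈T
      ... | yes q₁∈T | no q₂∉T =
        no-one (x~q₁ nice) (x~q₂ nice) (nice⇒degree-2 nice) q₁∈T q₂∉T
      ... | no q₁∉T | yes q₂∈T =
        no-one (x~q₂ nice) (x~q₁ nice) ([ inj₂ , inj₁ ]′ ∘ nice⇒degree-2 nice) q₂∈T q₁∉T
      ... | no q₁∉T | no q₂∉T =
        cherry-outweighs T≤ (x~q₁ nice) (x~q₂ nice) (q₁≢q₂ nice) no-y q₁∉T q₂∉T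
          w-y (w-nbr (x~q₁ nice)) (w-nbr (x~q₂ nice))
          (<-by (5 + 8 * m) (arith m))
        where
        arith : ∀ m → suc (17 + 16 * m) + (5 + 8 * m) ≡ (9 + 8 * m) + ((7 + 8 * m) + ((7 + 8 * m) + 0))
        arith = solve-∀

    impossible : ⊥
    impossible = gcs-refute conn gcs w w-pos (8 + 8 * m) ⟦ S? ⟧ (y , ∈⁺ S? (inj₁ refl))
      S-heavy S-light (λ T → no-T {T})

  -- The weighted path on five blocks

  -- The blocks in order are `J`, `U`, all remaining vertices, `V`, `K`: `J` meets the rest only
  -- through `U`, and `K` only through `V`. The edges `z ~ x` and `z′ ~ x′` between blocks are
  -- singled out to carry the heavy weights.
  record Dumbbell : Set where
    field
      U J V K : VSet n
      z x z′ x′ : Fin n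
      U-connected : ConnectedIn G U
      V-connected : ConnectedIn G V
      z∈U : z ∈ U
      x∈J : x ∈ J
      z′∈V : z′ ∈ V
      x′∈K : x′ ∈ K
      z~x : z ~ x
      z′~x′ : z′ ~ x′
      U∩J : ∀ {v} → v ∈ U → ¬ v ∈ J
      V∩K : ∀ {v} → v ∈ V → ¬ v ∈ K
      J-closed : ∀ {u v} → u ∈ J → u ~ v → v ∈ U ⊎ v ∈ J
      K-closed : ∀ {u v} → u ∈ K → u ~ v → v ∈ V ⊎ v ∈ K
      disjoint : ∀ {v} → v ∈ U ⊎ v ∈ J → ¬ (v ∈ V ⊎ v ∈ K)
      nonadjacent : ∀ {u v} → u ∈ U → v ∈ V → ¬ u ~ v

    A B : Fin n → Set
    A v = v ∈ U ⊎ v ∈ J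
    B v = v ∈ V ⊎ v ∈ K

    A? : ∀ v → Dec (A v)
    A? v = (v ∈? U) ⊎-dec (v ∈? J)

    B? : ∀ v → Dec (B v)
    B? v = (v ∈? V) ⊎-dec (v ∈? K)

    A≁B : ∀ {u v} → A u → B v → ¬ u ~ v
    A≁B (inj₂ u∈J) v∈B e = disjoint (J-closed u∈J e) v∈B
    A≁B (inj₁ u∈U) (inj₂ v∈K) e = disjoint (inj₁ u∈U) (K-closed v∈K (~-sym e))
    A≁B (inj₁ u∈U) (inj₁ v∈V) e = nonadjacent u∈U v∈V e

  -- Exchanges the ends, so that estimates are proved at one end only.
  mirror : Dumbbell → Dumbbell
  mirror d = record
    { U = V ; J = K ; V = U ; K = J ; z = z′ ; x = x′ ; z′ = z ; x′ = x
    ; U-connected = V-connected ; V-connected = U-connected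
    ; z∈U = z′∈V ; x∈J = x′∈K ; z′∈V = z∈U ; x′∈K = x∈J ; z~x = z′~x′ ; z′~x′ = z~x
    ; U∩J = V∩K ; V∩K = U∩J ; J-closed = K-closed ; K-closed = J-closed
    ; disjoint = λ b a → disjoint a b
    ; nonadjacent = λ v∈V u∈U e → nonadjacent u∈U v∈V (~-sym e) }
    where open Dumbbell d

  -- Weights: α on z and z′, β on x and x′, 1 elsewhere on the two sides, ρ off them; the
  -- safe set is U ∪ V. A connected T meeting both edges zx and z′x′ contains a vertex of
  -- weight ρ and is too heavy; a T avoiding one of these edges is outweighed on that side.
  ρ β α : ℕ
  ρ = 1 + 3 * n
  β = 1 + n * ρ
  α = β + n

  -- Stated apart from the weight itself so that it passes through `mirror`. On the constants: `J`
  -- weighs at most `β + n`, which is `α`; a vertex off the sides adds `ρ`, more than the 3n by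
  -- which the bound 2α + n exceeds 2β; and `n * ρ` stays below `β`.
  record Balanced (d : Dumbbell) (w : Fin n → ℕ) : Set where
    open Dumbbell d
    field
      w-z : w z ≡ α
      w-x : w x ≡ β
      w-z′ : w z′ ≡ α
      w-x′ : w x′ ≡ β
      w-side : ∀ {v} → A v ⊎ B v → v ≢ z → v ≢ x → v ≢ z′ → v ≢ x′ → w v ≡ 1
      w-rest : ∀ {v} → ¬ A v → ¬ B v → w v ≡ ρ

    w≤ρ : ∀ {v} → v ≢ z → v ≢ x → v ≢ z′ → v ≢ x′ → w v ≤ ρ
    w≤ρ {v} ≢z ≢x ≢z′ ≢x′ with A? v | B? v
    ... | yes a | _ = ℕ.≤-trans (ℕ.≤-reflexive (w-side (inj₁ a) ≢z ≢x ≢z′ ≢x′)) (s≤s z≤n)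
    ... | no _  | yes b = ℕ.≤-trans (ℕ.≤-reflexive (w-side (inj₂ b) ≢z ≢x ≢z′ ≢x′)) (s≤s z≤n)
    ... | no ¬a | no ¬b = ℕ.≤-reflexive (w-rest ¬a ¬b)

  balanced-mirror : ∀ {d w} → Balanced d w → Balanced (mirror d) w
  balanced-mirror b = record
    { w-z = w-z′ ; w-x = w-x′ ; w-z′ = w-z ; w-x′ = w-x
    ; w-side = λ s ≢z ≢x ≢z′ ≢x′ → w-side ([ inj₂ , inj₁ ]′ s) ≢z′ ≢x′ ≢z ≢x
    ; w-rest = λ ¬a ¬b → w-rest ¬b ¬a }
    where open Balanced b

  end-light : ∀ {d w} → Balanced d w → ∀ {D} → (∀ {v} → v ∈ D → v ∈ Dumbbell.J d) → wtℕ w D ≤ α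
  end-light {d} {w} bal {D} D⊆J = ℕ.≤-trans (wt-upper′ w (x ∷ []) 1 cover)
      (ℕ.≤-reflexive (trans (cong (λ k → k + 0 + n * 1) w-x) (arith n β)))
    where
    open Dumbbell d
    open Balanced bal
    cover : ∀ {v} → v ∈ D → v List.∈ (x ∷ []) ⊎ w v ≤ 1
    cover {v} v∈D with v ≟ x
    ... | yes e = inj₁ (here e)
    ... | no ≢x = inj₂ (ℕ.≤-reflexive (w-side (inj₁ (inj₂ (D⊆J v∈D)))
            (λ { refl → U∩J z∈U (D⊆J v∈D) }) ≢x
            (λ { refl → disjoint (inj₂ (D⊆J v∈D)) (inj₁ z′∈V) })
            (λ { refl → disjoint (inj₂ (D⊆J v∈D)) (inj₂ x′∈K) })))
    arith : ∀ n b → b + 0 + n * 1 ≡ b + n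
    arith = solve-∀

  module DumbbellRefute (d : Dumbbell) {w} (bal : Balanced d w) {T} (connT : ConnectedIn G T)
    (heaviest : ∀ D → ConnectedIn G D → D ⊆ complement T → ¬ wtℕ w T < wtℕ w D)
    (T≤ : wtℕ w T ≤ α + (α + 0) + n * 1) where
    open Dumbbell d
    open Balanced bal
    open Refute w connT heaviest

    in-side? : ∀ v → Dec (A v ⊎ B v)
    in-side? v = A? v ⊎-dec B? v

    -- If `x′` or `z′` is also missing from `T`, the edge `z ~ x` outweighs `T`. If both lie in `T`,
    -- a vertex off the sides makes `T` too heavy.
    misses : ¬ z ∈ T → ¬ x ∈ T → ⊥
    misses z∉T x∉T with x′ ∈? T | z′ ∈? T | sub? T ⟦ in-side? ⟧
    ... | no x′∉T | _ | _ =
      edge-outweighs (wt-upper′ w (z′ ∷ []) ρ cover) z~x z∉T x∉T w-z w-x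
        (subst (λ k → k + 0 + n * ρ < α + (β + 0)) (≡-sym w-z′) (<-by 0 (arith n (n * ρ))))
      where
      cover : ∀ {v} → v ∈ T → v List.∈ (z′ ∷ []) ⊎ w v ≤ ρ
      cover {v} v∈T with v ≟ z′
      ... | yes e = inj₁ (here e)
      ... | no v≢z′ = inj₂ (w≤ρ (λ { refl → z∉T v∈T }) (λ { refl → x∉T v∈T }) v≢z′ (λ { refl → x′∉T v∈T }))
      arith : ∀ n p → suc (1 + p + n + 0 + p) + 0 ≡ 1 + p + n + (1 + p + 0)
      arith = solve-∀
    ... | yes x′∈T | no z′∉T | _ =
      edge-outweighs (wt-upper′ w (x′ ∷ []) ρ cover) z~x z∉T x∉T w-z w-x
        (subst (λ k → k + 0 + n * ρ < α + (β + 0)) (≡-sym w-x′) (<-by n (arith n (n * ρ))))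
      where
      cover : ∀ {v} → v ∈ T → v List.∈ (x′ ∷ []) ⊎ w v ≤ ρ
      cover {v} v∈T with v ≟ x′
      ... | yes e = inj₁ (here e)
      ... | no v≢x′ = inj₂ (w≤ρ (λ { refl → z∉T v∈T }) (λ { refl → x∉T v∈T }) (λ { refl → z′∉T v∈T }) v≢x′)
      arith : ∀ n p → suc (1 + p + 0 + p) + n ≡ 1 + p + n + (1 + p + 0)
      arith = solve-∀
    ... | yes x′∈T | yes z′∈T | inj₁ (r , r∈T , r∉side) =
      overweight (z′ ∷ x′ ∷ r ∷ []) T≤ (≡⇒≥ w-z′ ∷ ≡⇒≥ w-x′ ∷ ≡⇒≥ (w-rest (r∉ ∘ inj₁) (r∉ ∘ inj₂)) ∷ [])
        ((~⇒≢ z′~x′ ∷ (λ { refl → r∉ (inj₂ (inj₁ z′∈V)) }) ∷ []) ∷ ((λ { refl → r∉ (inj₂ (inj₂ x′∈K)) }) ∷ []) ∷ [] ∷ [])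
        (z′∈T ∷ x′∈T ∷ r∈T ∷ []) (<-by n (arith n (n * ρ)))
      where
      r∉ : ¬ (A r ⊎ B r)
      r∉ = r∉side ∘ ∈⁺ in-side?
      arith : ∀ n p → suc (1 + p + n + (1 + p + n + 0) + n * 1) + n
                    ≡ 1 + p + n + (1 + p + (1 + 3 * n + 0))
      arith = solve-∀
    -- Here `T` stays in `B` and weighs at most `α + β + n`. An edge leaving `A` starts in `U` and
    -- ends at a vertex `r` of weight `ρ`; adding `x` and `r` to `U` gives a competitor of weight at
    -- least `α + β + ρ`.
    ... | yes x′∈T | yes z′∈T | inj₂ T⊆side
      with a , r , _ , _ , a∈A , r∉A , a~r ← exit-edge ⟦ A? ⟧ conn {z} {z′} refl refl
             (∈⁺ A? (inj₁ z∈U)) (λ z′∈A → disjoint (∈⁻ A? z′∈A) (inj₁ z′∈V)) =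
      outweighed′ (z ∷ x ∷ r ∷ []) (wt-upper′ w (z′ ∷ x′ ∷ []) 1 cover)
        (grow-connected U-connected (λ v v∈U → ∈⁺ D? (inj₂ (inj₂ v∈U))) λ v∈D → case ∈⁻ D? v∈D of λ where
          (inj₁ refl) → inj₂ (z , z∈U , z~x)
          (inj₂ (inj₁ refl)) → inj₂ (a , a∈U , a~r)
          (inj₂ (inj₂ v∈U)) → inj₁ v∈U)
        (λ v∈D v∈T → case ∈⁻ D? v∈D of λ where
          (inj₁ refl) → disjoint (inj₂ x∈J) (T⊆B v∈T)
          (inj₂ (inj₁ refl)) → r∉B (T⊆B v∈T)
          (inj₂ (inj₂ v∈U)) → disjoint (inj₁ v∈U) (T⊆B v∈T))
        (≡⇒≥ w-z ∷ ≡⇒≥ w-x ∷ ≡⇒≥ (w-rest (r∉A ∘ ∈⁺ A?) r∉B) ∷ [])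
        ((~⇒≢ z~x ∷ (λ { refl → r∉A (∈⁺ A? (inj₁ z∈U)) }) ∷ []) ∷ ((λ { refl → r∉A (∈⁺ A? (inj₂ x∈J)) }) ∷ []) ∷ [] ∷ [])
        (∈⁺ D? (inj₂ (inj₂ z∈U)) ∷ ∈⁺ D? (inj₁ refl) ∷ ∈⁺ D? (inj₂ (inj₁ refl)) ∷ [])
        (subst (_< α + (β + (ρ + 0))) (≡-sym (cong₂ (λ i j → i + (j + 0) + n * 1) w-z′ w-x′))
          (<-by (2 * n) (arith n (n * ρ))))
      where
      r∉B : ¬ B r
      r∉B r∈B = A≁B (∈⁻ A? a∈A) r∈B a~r
      a∈U : a ∈ U
      a∈U with ∈⁻ A? a∈A
      ... | inj₁ a∈U = a∈U
      ... | inj₂ a∈J = contradiction (∈⁺ A? (J-closed a∈J a~r)) r∉A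
      T⊆B : ∀ {v} → v ∈ T → B v
      T⊆B v∈T = connected-transport B connT
        (λ _ v∈T e u∈B → case ∈⁻ in-side? (T⊆side _ v∈T) of λ where
          (inj₁ v∈A) → contradiction (~-sym e) (A≁B v∈A u∈B)
          (inj₂ v∈B) → v∈B)
        z′∈T v∈T (inj₁ z′∈V)
      D? : ∀ v → Dec (v ≡ x ⊎ v ≡ r ⊎ v ∈ U)
      D? v = (v ≟ x) ⊎-dec (v ≟ r) ⊎-dec (v ∈? U)
      cover : ∀ {v} → v ∈ T → v List.∈ (z′ ∷ x′ ∷ []) ⊎ w v ≤ 1
      cover {v} v∈T with v ≟ z′ | v ≟ x′
      ... | yes e | _ = inj₁ (here e)
      ... | no _ | yes e = inj₁ (there (here e))
      ... | no v≢z′ | no v≢x′ = inj₂ (ℕ.≤-reflexive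
              (w-side (inj₂ (T⊆B v∈T)) (λ { refl → z∉T v∈T }) (λ { refl → x∉T v∈T }) v≢z′ v≢x′))
      arith : ∀ n p → suc (1 + p + n + (1 + p + 0) + n * 1) + 2 * n
                    ≡ 1 + p + n + (1 + p + (1 + 3 * n + 0))
      arith = solve-∀

    -- No edge joins the two sides, so a connected `T` meeting both contains a vertex of weight `ρ`,
    -- and 2β + ρ is one more than the bound on `T`.
    hits-both : ∀ {s s′} → A s → B s′ → β ≤ w s → β ≤ w s′ → s ∈ T → ¬ s′ ∈ T
    hits-both {s} {s′} s∈A s′∈B β≤s β≤s′ s∈T s′∈T with sub? T ⟦ in-side? ⟧
    ... | inj₂ T⊆side = disjoint
      (connected-transport A connT
        (λ _ v∈T e u∈A → case ∈⁻ in-side? (T⊆side _ v∈T) of λ where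
          (inj₁ v∈A) → v∈A
          (inj₂ v∈B) → contradiction e (A≁B u∈A v∈B))
        s∈T s′∈T s∈A) s′∈B
    ... | inj₁ (r , r∈T , r∉side) =
      overweight (s ∷ s′ ∷ r ∷ []) T≤ (β≤s ∷ β≤s′ ∷ ≡⇒≥ (w-rest (r∉ ∘ inj₁) (r∉ ∘ inj₂)) ∷ [])
        (((λ { refl → disjoint s∈A s′∈B }) ∷ (λ { refl → r∉ (inj₁ s∈A) }) ∷ []) ∷ ((λ { refl → r∉ (inj₂ s′∈B) }) ∷ []) ∷ [] ∷ [])
        (s∈T ∷ s′∈T ∷ r∈T ∷ []) (<-by 0 (arith n (n * ρ)))
      where
      r∉ : ¬ (A r ⊎ B r)
      r∉ = r∉side ∘ ∈⁺ in-side?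
      arith : ∀ n p → suc (1 + p + n + (1 + p + n + 0) + n * 1) + 0
                    ≡ 1 + p + (1 + p + (1 + 3 * n + 0))
      arith = solve-∀

  module _ (d : Dumbbell) where
    open Dumbbell d

    -- Opaque, since all later steps go through `balanced` and positivity.
    opaque
      dumbbell-weight : Fin n → ℕ
      dumbbell-weight v =
        if does ((v ≟ z) ⊎-dec (v ≟ z′)) then α
        else if does ((v ≟ x) ⊎-dec (v ≟ x′)) then β
        else if does (A? v ⊎-dec B? v) then 1 else ρ

      balanced : Balanced d dumbbell-weight
      balanced = record
        { w-z = heavy (inj₁ refl) ; w-z′ = heavy (inj₂ refl)
        ; w-x = end (inj₁ refl) x≢z (λ { refl → disjoint (inj₂ x∈J) (inj₁ z′∈V) })
        ; w-x′ = end (inj₂ refl) (λ { refl → disjoint (inj₁ z∈U) (inj₂ x′∈K) }) x′≢z′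
        ; w-side = side ; w-rest = rest }
        where
        x≢z : x ≢ z
        x≢z = ≢-sym (~⇒≢ z~x)
        x′≢z′ : x′ ≢ z′
        x′≢z′ = ≢-sym (~⇒≢ z′~x′)
        heavy : ∀ {v} → v ≡ z ⊎ v ≡ z′ → dumbbell-weight v ≡ α
        heavy {v} e rewrite dec-true ((v ≟ z) ⊎-dec (v ≟ z′)) e = refl
        end : ∀ {v} → v ≡ x ⊎ v ≡ x′ → v ≢ z → v ≢ z′ → dumbbell-weight v ≡ β
        end {v} e ≢z ≢z′
          rewrite dec-false ((v ≟ z) ⊎-dec (v ≟ z′)) [ ≢z , ≢z′ ]′
                | dec-true ((v ≟ x) ⊎-dec (v ≟ x′)) e = refl
        side : ∀ {v} → A v ⊎ B v → v ≢ z → v ≢ x → v ≢ z′ → v ≢ x′ → dumbbell-weight v ≡ 1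
        side {v} s ≢z ≢x ≢z′ ≢x′
          rewrite dec-false ((v ≟ z) ⊎-dec (v ≟ z′)) [ ≢z , ≢z′ ]′
                | dec-false ((v ≟ x) ⊎-dec (v ≟ x′)) [ ≢x , ≢x′ ]′
                | dec-true (A? v ⊎-dec B? v) s = refl
        rest : ∀ {v} → ¬ A v → ¬ B v → dumbbell-weight v ≡ ρ
        rest {v} ¬a ¬b
          rewrite dec-false ((v ≟ z) ⊎-dec (v ≟ z′))
                    [ (λ { refl → ¬a (inj₁ z∈U) }) , (λ { refl → ¬b (inj₁ z′∈V) }) ]′
                | dec-false ((v ≟ x) ⊎-dec (v ≟ x′))
                    [ (λ { refl → ¬a (inj₂ x∈J) }) , (λ { refl → ¬b (inj₂ x′∈K) }) ]′
                | dec-false (A? v ⊎-dec B? v) [ ¬a , ¬b ]′ = refl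

      dumbbell-weight-pos : ∀ v → 0 < dumbbell-weight v
      dumbbell-weight-pos v
        with does ((v ≟ z) ⊎-dec (v ≟ z′)) | does ((v ≟ x) ⊎-dec (v ≟ x′)) | does (A? v ⊎-dec B? v)
      ... | true  | _     | _     = s≤s z≤n
      ... | false | true  | _     = s≤s z≤n
      ... | false | false | true  = s≤s z≤n
      ... | false | false | false = s≤s z≤n

    no-dumbbell : ⊥
    no-dumbbell = gcs-refute conn gcs w dumbbell-weight-pos α ⟦ S? ⟧ (z , ∈⁺ S? (inj₁ z∈U)) S-heavy S-light λ T connT heaviest T≤S →
      let T≤ = ℕ.≤-trans T≤S S-weight
          open DumbbellRefute d balanced connT heaviest T≤ using (misses; hits-both)
          module M = DumbbellRefute (mirror d) (balanced-mirror balanced) connT heaviest T≤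
          β≤α = ℕ.m≤m+n β n
          β≤z = ℕ.≤-trans β≤α (≡⇒≥ w-z)
          β≤z′ = ℕ.≤-trans β≤α (≡⇒≥ w-z′)
          β≤x = ≡⇒≥ w-x
          β≤x′ = ≡⇒≥ w-x′
      -- A `T` containing `z` or `x` misses both `z′` and `x′` by `hits-both`, which the mirrored
      -- `misses` excludes.
      in misses
           (λ z∈T → M.misses (hits-both (inj₁ z∈U) (inj₁ z′∈V) β≤z β≤z′ z∈T)
                             (hits-both (inj₁ z∈U) (inj₂ x′∈K) β≤z β≤x′ z∈T))
           (λ x∈T → M.misses (hits-both (inj₂ x∈J) (inj₁ z′∈V) β≤x β≤z′ x∈T)
                             (hits-both (inj₂ x∈J) (inj₂ x′∈K) β≤x β≤x′ x∈T))
      where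
      open Balanced balanced
      w : Fin n → ℕ
      w = dumbbell-weight
      S? : ∀ v → Dec (v ∈ U ⊎ v ∈ V)
      S? v = (v ∈? U) ⊎-dec (v ∈? V)
      S-weight : wtℕ w ⟦ S? ⟧ ≤ α + (α + 0) + n * 1
      S-weight = subst (wtℕ w ⟦ S? ⟧ ≤_) (cong₂ (λ i j → i + (j + 0) + n * 1) w-z w-z′)
          (wt-upper′ w (z ∷ z′ ∷ []) 1 cover)
        where
        cover : ∀ {v} → v ∈ ⟦ S? ⟧ → v List.∈ (z ∷ z′ ∷ []) ⊎ w v ≤ 1
        cover {v} v∈S with v ≟ z | v ≟ z′ | ∈⁻ S? v∈S
        ... | yes e | _ | _ = inj₁ (here e)
        ... | no _ | yes e | _ = inj₁ (there (here e))
        ... | no ≢z | no ≢z′ | inj₁ v∈U = inj₂ (ℕ.≤-reflexive (w-side (inj₁ (inj₁ v∈U)) ≢z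
                (λ { refl → U∩J v∈U x∈J }) ≢z′ (λ { refl → disjoint (inj₁ v∈U) (inj₂ x′∈K) })))
        ... | no ≢z | no ≢z′ | inj₂ v∈V = inj₂ (ℕ.≤-reflexive (w-side (inj₂ (inj₁ v∈V)) ≢z
                (λ { refl → disjoint (inj₂ x∈J) (inj₁ v∈V) }) ≢z′ (λ { refl → V∩K v∈V x′∈K })))
      absorbs : ∀ {C X c} → IsComponent G ⟦ S? ⟧ C → ConnectedIn G X → X ⊆ ⟦ S? ⟧ → c ∈ X → c ∈ C →
        ∀ {v} → v ∈ X → v ∈ C
      absorbs {C} (_ , _ , closed) connX X⊆S c∈X c∈C v∈X =
        connected-transport (_∈ C) connX (λ _ y∈X e u∈C → closed _ _ u∈C (X⊆S _ y∈X) e) c∈X v∈X c∈C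
      at-least : ∀ {C v} → v ∈ C → w v ≡ α → α ≤ wtℕ w C
      at-least {C} {v} v∈C e = subst (_≤ wtℕ w C) (trans (ℕ.+-identityʳ (w v)) e)
        (wt-lower′ w (v ∷ []) {C} ([] ∷ []) (v∈C ∷ []))
      S-heavy : ∀ C → IsComponent G ⟦ S? ⟧ C → α ≤ wtℕ w C
      S-heavy C comp@(C⊆S , ((c , c∈C) , _) , _) with ∈⁻ S? (C⊆S c c∈C)
      ... | inj₁ c∈U = at-least {C} (absorbs {C} comp U-connected (λ v v∈U → ∈⁺ S? (inj₁ v∈U)) c∈U c∈C z∈U) w-z
      ... | inj₂ c∈V = at-least {C} (absorbs {C} comp V-connected (λ v v∈V → ∈⁺ S? (inj₂ v∈V)) c∈V c∈C z′∈V) w-z′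
      -- A connected set outside the safe set lies in `J`, in `K`, or off both sides; in the last
      -- case `n * ρ` bounds its weight.
      S-light : ∀ D → ConnectedIn G D → D ⊆ complement ⟦ S? ⟧ → wtℕ w D ≤ α
      S-light D connD@((c , c∈D) , _) D⊆ with c ∈? J | c ∈? K
      ... | yes c∈J | _ = end-light balanced λ v∈D → connected-transport (_∈ J) connD
          (λ _ v∈D e u∈J → case J-closed u∈J e of λ where
            (inj₁ v∈U) → contradiction (∈⁺ S? (inj₁ v∈U)) (∈∁⇒∉ ⟦ S? ⟧ (D⊆ _ v∈D))
            (inj₂ v∈J) → v∈J) c∈D v∈D c∈J
      ... | no _ | yes c∈K = end-light (balanced-mirror balanced) λ v∈D → connected-transport (_∈ K) connD
          (λ _ v∈D e u∈K → case K-closed u∈K e of λ where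
            (inj₁ v∈V) → contradiction (∈⁺ S? (inj₂ v∈V)) (∈∁⇒∉ ⟦ S? ⟧ (D⊆ _ v∈D))
            (inj₂ v∈K) → v∈K) c∈D v∈D c∈K
      ... | no c∉J | no c∉K = ℕ.≤-trans (wt-bound w ρ λ v∈D →
              ℕ.≤-reflexive (uncurry w-rest (D-rest v∈D)))
              (≤-by (1 + n) (arith n (n * ρ)))
        where
        outside : ∀ {v} → v ∈ D → ¬ v ∈ J → ¬ v ∈ K → ¬ A v × ¬ B v
        outside v∈D ∉J ∉K =
          [ (λ v∈U → ∈∁⇒∉ ⟦ S? ⟧ (D⊆ _ v∈D) (∈⁺ S? (inj₁ v∈U))) , ∉J ]′ ,
          [ (λ v∈V → ∈∁⇒∉ ⟦ S? ⟧ (D⊆ _ v∈D) (∈⁺ S? (inj₂ v∈V))) , ∉K ]′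
        D-rest : ∀ {v} → v ∈ D → ¬ A v × ¬ B v
        D-rest v∈D = connected-transport (λ v → ¬ A v × ¬ B v) connD
          (λ _ v∈D e (¬a , ¬b) → outside v∈D (λ v∈J → ¬a (J-closed v∈J (~-sym e)))
                                              (λ v∈K → ¬b (K-closed v∈K (~-sym e))))
          c∈D v∈D (outside c∈D c∉J c∉K)
        arith : ∀ n p → p + (1 + n) ≡ 1 + p + n
        arith = solve-∀

  -- Connected subsets of `H y` for a nice `y`

  -- Adjacent vertices are added to `K` one at a time; the last one added is `j`, since everything
  -- before it is connected. The fuel bounds the number of vertices of `A` still outside `K`.
  peel : ∀ {A K} → ConnectedIn G A → ConnectedIn G K → K ⊆ A → ∀ {v} → v ∈ A → ¬ v ∈ K →
    ∃ λ j → j ∈ A × ¬ j ∈ K × ConnectedIn G (A ∖ j)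
  peel {A} {K} connA connK K⊆A = go ∣ A ∣ connK K⊆A (ℕ.m≤m+n ∣ A ∣ ∣ K ∣)
    where
    add? : ∀ (K : VSet n) y u → Dec (u ∈ K ⊎ u ≡ y)
    add? K y u = (u ∈? K) ⊎-dec (u ≟ y)
    ⊆-add : ∀ (K : VSet n) y → K ⊆ ⟦ add? K y ⟧
    ⊆-add K y u u∈K = ∈⁺ (add? K y) (inj₁ u∈K)
    size-< : ∀ {X Y : VSet n} {v} → X ⊆ Y → v ∈ Y → ¬ v ∈ X → ∣ X ∣ < ∣ Y ∣
    size-< {X} {Y} X⊆Y v∈Y v∉X = wt-lower (λ _ → 1) (_ ∷ []) {Y} {X} ([] ∷ []) (v∈Y ∷ []) X⊆Y (v∉X ∷ [])
    go : ∀ fuel {K} → ConnectedIn G K → K ⊆ A → ∣ A ∣ ≤ fuel + ∣ K ∣ → ∀ {v} → v ∈ A → ¬ v ∈ K →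
      ∃ λ j → j ∈ A × ¬ j ∈ K × ConnectedIn G (A ∖ j)
    go zero {K} connK K⊆A A≤K v∈A v∉K = contradiction A≤K (ℕ.<⇒≱ (size-< {K} K⊆A v∈A v∉K))
    go (suc fuel) {K} connK@((k , k∈K) , _) K⊆A A≤ v∈A v∉K
      with x , y , _ , y∈A , x∈K , y∉K , x~y ← exit-edge K connA (K⊆A k k∈K) v∈A k∈K v∉K
      with sub? A ⟦ (add? K y) ⟧
    ... | inj₂ A⊆K′ = y , y∈A , y∉K ,
            grow-connected connK (λ u u∈K → ∈∖⁺ A (K⊆A u u∈K) λ { refl → y∉K u∈K }) λ {d} d∈ →
              let d∈A , d≢y = ∈∖⁻ A d∈ in
              case ∈⁻ (add? K y) (A⊆K′ d d∈A) of λ where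
                (inj₁ d∈K) → inj₁ d∈K
                (inj₂ e)   → contradiction e d≢y
    ... | inj₁ (u , u∈A , u∉K′)
      with j , j∈A , j∉K′ , connJ ← go fuel {⟦ add? K y ⟧}
             (grow-connected connK (⊆-add K y) λ d∈ → case ∈⁻ (add? K y) d∈ of λ where
               (inj₁ d∈K) → inj₁ d∈K
               (inj₂ refl) → inj₂ (x , x∈K , x~y))
             (λ d d∈ → case ∈⁻ (add? K y) d∈ of λ where
               (inj₁ d∈K) → K⊆A d d∈K
               (inj₂ refl) → y∈A)
             (ℕ.≤-trans A≤ (subst (_≤ fuel + ∣ ⟦ add? K y ⟧ ∣) (ℕ.+-suc fuel ∣ K ∣)
               (ℕ.+-monoʳ-≤ fuel (size-< {K} (⊆-add K y) (∈⁺ (add? K y) (inj₂ refl)) y∉K))))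
             u∈A u∉K′ = j , j∈A , j∉K′ ∘ ∈⁺ (add? K y) ∘ inj₁ , connJ

  -- A vertex of `H y` outside `K` would let `peel` find a removable `j` outside `K`; by `contact`
  -- neither `q₁ nice` nor `q₂ nice` is adjacent to it, which `Removable` excludes.
  H-minimal : ∀ {y K} → Nice y → ConnectedIn G K → K ⊆ H y →
    (∀ {q h} → y ~ q → q ~ h → h ∈ H y → h ∈ K) → H y ⊆ K
  H-minimal {y} {K} nice connK K⊆H contact v v∈H = decidable-stable (v ∈? K) λ v∉K →
    let j , j∈H , j∉K , connJ = peel (H-connected nice) connK K⊆H v∈H v∉K
    in Removable.impossible nice j∈H (λ e → j∉K (contact (x~q₁ nice) e j∈H))
         (λ e → j∉K (contact (x~q₂ nice) e j∈H)) connJ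

  -- Distant vertices and pendant parts

  -- Distance at least 3, expressed by excluding walks of length 0, 1 and 2.
  record Distant (x y : Fin n) : Set where
    constructor distant
    field
      x≢y : x ≢ y
      x≁y : ¬ x ~ y
      no-common : ∀ {p} → x ~ p → ¬ y ~ p

  -- Distance at least 4: walks of length 3 are excluded too.
  record Far (x y : Fin n) : Set where
    constructor far
    field
      is-distant : Distant x y
      no-link : ∀ {p q} → x ~ p → y ~ q → ¬ p ~ q

  open Distant
  open Far

  distant-sym : ∀ {x y} → Distant x y → Distant y x
  distant-sym d = distant (≢-sym (x≢y d)) (x≁y d ∘ ~-sym) (λ y~p x~p → no-common d x~p y~p)

  far-sym : ∀ {x y} → Far x y → Far y x
  far-sym f = far (distant-sym (is-distant f)) (λ y~q x~p q~p → no-link f x~p y~q (~-sym q~p))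

  far⇒nbr-distant : ∀ {x y p} → Far x y → x ~ p → Distant p y
  far⇒nbr-distant f x~p = distant (λ { refl → x≁y (is-distant f) x~p })
    (λ p~y → no-common (is-distant f) x~p (~-sym p~y))
    (λ p~q y~q → no-link f x~p y~q p~q)

  -- Keeping `J` off the closed neighbourhood of `y` is what separates the parts of two far vertices
  -- and what conflicts with a nice `y`.
  record Pendant (t y : Fin n) : Set where
    field
      U J : VSet n
      U-connected : ConnectedIn G U
      U-near : ∀ {v} → v ∈ U → v ≡ t ⊎ t ~ v
      U∩J : ∀ {v} → v ∈ U → ¬ v ∈ J
      J-nonempty : ∃ λ v → v ∈ J
      J-closed : ∀ {u v} → u ∈ J → u ~ v → v ∈ U ⊎ v ∈ J
      J-far : ∀ {v} → v ∈ J → v ≢ y × ¬ y ~ v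

  -- Each failure of niceness yields a part. If `H t` is disconnected, what `y` does not reach in it
  -- hangs on the closed neighbourhood of `t`; a neighbour of `t` without neighbours in `H t` is a
  -- leaf hanging on `t`; and if `t` is itself a leaf, it hangs on its only neighbour.
  pendant-or-nice : ∀ {t y} → Distant t y → ¬ ¬ (Pendant t y ⊎ Nice t)
  pendant-or-nice {t} {y} d k = comprehension (ReachIn G (H t) y) λ (C , spec) → k (decide C spec)
    where
    y∈H : y ∈ H t
    y∈H = ∈H⁺ (≢-sym (x≢y d)) (x≁y d)

    single-connected : ∀ v → ConnectedIn G ⟦ _≟ v ⟧
    single-connected v = star⇒connected (∈⁺ (_≟ v) refl) (inj₁ ∘ ∈⁻ (_≟ v))

    single-pendant : ∀ u j → u ≡ t ⊎ t ~ u → u ≢ j → (∀ {v} → j ~ v → v ≡ u) → j ≢ y → ¬ y ~ j → Pendant t y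
    single-pendant u j near u≢j only j≢y y≁j = record
      { U = ⟦ _≟ u ⟧ ; J = ⟦ _≟ j ⟧
      ; U-connected = single-connected u
      ; U-near = λ v∈ → subst (λ v → v ≡ t ⊎ t ~ v) (≡-sym (∈⁻ (_≟ u) v∈)) near
      ; U∩J = λ v∈U v∈J → u≢j (trans (≡-sym (∈⁻ (_≟ u) v∈U)) (∈⁻ (_≟ j) v∈J))
      ; J-nonempty = j , ∈⁺ (_≟ j) refl
      ; J-closed = λ {w} {v} w∈J e → inj₁ (∈⁺ (_≟ u) (only (subst (_~ v) (∈⁻ (_≟ j) w∈J) e)))
      ; J-far = λ v∈J → subst (λ v → v ≢ y × ¬ y ~ v) (≡-sym (∈⁻ (_≟ j) v∈J)) (j≢y , y≁j) }

    decide : ∀ C → (∀ v → (v ∈ C → ReachIn G (H t) y v) × (ReachIn G (H t) y v → v ∈ C)) → Pendant t y ⊎ Nice t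
    decide C spec
      with sub? (H t) C
         | any? (λ p → (t ~? p) ×-dec ¬? (any? λ h → (h ∈? H t) ×-dec (p ~? h)))
         | neighbour-in {u = t} {v = y} conn refl refl (x≢y d)
    ... | inj₁ (v , v∈H , v∉C) | _ | _ = inj₁ record
      { U = ⟦ N? ⟧ ; J = ⟦ J? ⟧
      ; U-connected = star⇒connected (∈⁺ N? (inj₁ refl)) (∈⁻ N?)
      ; U-near = ∈⁻ N?
      ; U∩J = λ v∈U v∈J → case ∈⁻ N? v∈U of λ where
          (inj₁ e) → proj₁ (∈H⁻ (proj₁ (∈⁻ J? v∈J))) e
          (inj₂ e) → proj₂ (∈H⁻ (proj₁ (∈⁻ J? v∈J))) e
      ; J-nonempty = v , ∈⁺ J? (v∈H , v∉C)
      ; J-closed = closed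
      ; J-far = λ v∈J →
          (λ { refl → proj₂ (∈⁻ J? v∈J) (proj₂ (spec y) (_ , here y∈H)) }) ,
          (λ y~v → proj₂ (∈⁻ J? v∈J) (proj₂ (spec _) (reach-edge y∈H (proj₁ (∈⁻ J? v∈J)) y~v))) }
      where
      N? : ∀ v → Dec (v ≡ t ⊎ t ~ v)
      N? v = (v ≟ t) ⊎-dec (t ~? v)
      J? : ∀ v → Dec (v ∈ H t × ¬ v ∈ C)
      J? v = (v ∈? H t) ×-dec ¬? (v ∈? C)
      closed : ∀ {u v} → u ∈ ⟦ J? ⟧ → u ~ v → v ∈ ⟦ N? ⟧ ⊎ v ∈ ⟦ J? ⟧
      closed {u} {v} u∈J u~v with trichotomy t v
      ... | inj₁ e = inj₁ (∈⁺ N? (inj₁ e))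
      ... | inj₂ (inj₁ e) = inj₁ (∈⁺ N? (inj₂ e))
      ... | inj₂ (inj₂ v∈H) = inj₂ (∈⁺ J? (v∈H , λ v∈C → proj₂ (∈⁻ J? u∈J) (proj₂ (spec u)
              (reach-trans (proj₁ (spec v) v∈C) (reach-edge v∈H (proj₁ (∈⁻ J? u∈J)) (~-sym u~v))))))
    ... | inj₂ _ | yes (p , t~p , stuck) | _ =
      inj₁ (single-pendant t p (inj₁ refl) (~⇒≢ t~p) only
             (λ { refl → x≁y d t~p }) (no-common d t~p))
      where
      only : ∀ {v} → p ~ v → v ≡ t
      only {v} p~v with trichotomy t v
      ... | inj₁ e = e
      ... | inj₂ (inj₁ t~v) = ⊥-elim (triangle-free _ _ _ t~p p~v t~v)
      ... | inj₂ (inj₂ v∈H) = contradiction (v , v∈H , p~v) stuck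
    ... | inj₂ H⊆C | no into | p , _ , t~p with any? (λ q → (t ~? q) ×-dec ¬? (q ≟ p))
    ...   | no lone = inj₁ (single-pendant p t (inj₂ t~p) (≢-sym (~⇒≢ t~p))
              (λ {v} t~v → decidable-stable (v ≟ p) λ v≢p → lone (v , t~v , v≢p))
              (x≢y d) (x≁y d ∘ ~-sym))
    ...   | yes (q , t~q , q≢p) = inj₂ record
      { H-connected = hub⇒connected y∈H λ {v} v∈H → proj₁ (spec v) (H⊆C v v∈H)
      ; into-H = λ {p} t~p → decidable-stable (any? λ h → (h ∈? H t) ×-dec (p ~? h)) λ ¬h → into (p , t~p , ¬h)
      ; q₁ = p ; q₂ = q ; x~q₁ = t~p ; x~q₂ = t~q ; q₁≢q₂ = ≢-sym q≢p }

  -- Deleting `J` from `H y` leaves a connected set, as `U` bridges any passage through `J`, and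
  -- keeps all vertices of `H y` adjacent to a neighbour of `y`. `H-minimal` then leaves no room for
  -- `J`.
  nice⇒no-pendant : ∀ {t y} → Nice y → Distant t y → ¬ Pendant t y
  nice⇒no-pendant {t} {y} nice d pen = proj₂ (∈⁻ K? (H-minimal nice K-connected (λ v v∈K → proj₁ (∈⁻ K? v∈K)) contact j j∈H)) j∈J
    where
    open Pendant pen
    j : Fin n
    j = proj₁ J-nonempty
    j∈J : j ∈ J
    j∈J = proj₂ J-nonempty
    j∈H : j ∈ H y
    j∈H = ∈H⁺ (proj₁ (J-far j∈J)) (proj₂ (J-far j∈J))
    K? : ∀ v → Dec (v ∈ H y × ¬ v ∈ J)
    K? v = (v ∈? H y) ×-dec ¬? (v ∈? J)
    U⊆K : U ⊆ ⟦ K? ⟧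
    U⊆K v v∈U = ∈⁺ K? (∈H⁺
      (λ { refl → case U-near v∈U of λ { (inj₁ refl) → x≢y d refl ; (inj₂ t~y) → x≁y d t~y } })
      (λ y~v → case U-near v∈U of λ { (inj₁ refl) → x≁y d (~-sym y~v) ; (inj₂ t~v) → no-common d t~v y~v }) ,
      U∩J v∈U)
    contact : ∀ {q h} → y ~ q → q ~ h → h ∈ H y → h ∈ ⟦ K? ⟧
    contact y~q q~h h∈H = ∈⁺ K? (h∈H , λ h∈J → case J-closed h∈J (~-sym q~h) of λ where
      (inj₁ q∈U) → proj₂ (∈H⁻ (proj₁ (∈⁻ K? (U⊆K _ q∈U)))) y~q
      (inj₂ q∈J) → proj₂ (J-far q∈J) y~q)
    u : Fin n
    u = proj₁ (proj₁ U-connected)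
    u∈U : u ∈ U
    u∈U = proj₂ (proj₁ U-connected)
    u∈K : u ∈ ⟦ K? ⟧
    u∈K = U⊆K u u∈U
    K-connected : ConnectedIn G ⟦ K? ⟧
    K-connected = hub⇒connected u∈K λ {v} v∈K →
      connected-transport (λ v → v ∈ ⟦ K? ⟧ → ReachIn G ⟦ K? ⟧ u v) (H-connected nice) extend
        (proj₁ (∈⁻ K? u∈K)) (proj₁ (∈⁻ K? v∈K)) (λ u∈K → _ , here u∈K) v∈K
      where
      -- A walk leaving `J` re-enters at `U`, all of which is reachable from `u`, so the stretch
      -- inside `J` is skipped.
      extend : ∀ {v v′} → v ∈ H y → v′ ∈ H y → v ~ v′ →
        (v ∈ ⟦ K? ⟧ → ReachIn G ⟦ K? ⟧ u v) → v′ ∈ ⟦ K? ⟧ → ReachIn G ⟦ K? ⟧ u v′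
      extend {v} {v′} v∈H _ v~v′ reach v′∈K with v ∈? J
      ... | no v∉J = reach-trans (reach (∈⁺ K? (v∈H , v∉J))) (reach-edge (∈⁺ K? (v∈H , v∉J)) v′∈K v~v′)
      ... | yes v∈J with J-closed v∈J v~v′
      ...   | inj₁ v′∈U = _ , walk-mono U⊆K (proj₂ (proj₂ U-connected u v′ u∈U v′∈U))
      ...   | inj₂ v′∈J = contradiction v′∈J (proj₂ (∈⁻ K? v′∈K))

  distant⇒nice : ∀ {t y} → Nice y → Distant t y → ¬ ¬ Nice t
  distant⇒nice nice d k = pendant-or-nice d [ nice⇒no-pendant nice d , k ]′

  module _ {t y} (pen : Pendant t y) where
    open Pendant pen

    pendant-edge : ∃ λ z → ∃ λ x → z ∈ U × x ∈ J × z ~ x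
    pendant-edge
      with x , z , _ , _ , x∈J , z∉J , e ← exit-edge J conn {_} {y} refl refl (proj₂ J-nonempty)
                                             (λ y∈J → proj₁ (J-far y∈J) refl)
      with J-closed x∈J e
    ... | inj₁ z∈U = z , x , z∈U , x∈J , ~-sym e
    ... | inj₂ z∈J = contradiction z∈J z∉J

  no-far-pendants : ∀ {x y} → Far x y → Pendant x y → ¬ Pendant y x
  no-far-pendants {x} {y} f P Q = no-dumbbell record
    { U = P.U ; J = P.J ; V = Q.U ; K = Q.J
    ; z = proj₁ p-edge ; x = proj₁ (proj₂ p-edge) ; z′ = proj₁ q-edge ; x′ = proj₁ (proj₂ q-edge)
    ; U-connected = P.U-connected ; V-connected = Q.U-connected
    ; z∈U = proj₁ (proj₂ (proj₂ p-edge)) ; x∈J = proj₁ (proj₂ (proj₂ (proj₂ p-edge)))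
    ; z′∈V = proj₁ (proj₂ (proj₂ q-edge)) ; x′∈K = proj₁ (proj₂ (proj₂ (proj₂ q-edge)))
    ; z~x = proj₂ (proj₂ (proj₂ (proj₂ p-edge))) ; z′~x′ = proj₂ (proj₂ (proj₂ (proj₂ q-edge)))
    ; U∩J = P.U∩J ; V∩K = Q.U∩J ; J-closed = P.J-closed ; K-closed = Q.J-closed
    ; disjoint = disjoint ; nonadjacent = nonadjacent }
    where
    module P = Pendant P
    module Q = Pendant Q
    p-edge : ∃ λ z → ∃ λ x → z ∈ P.U × x ∈ P.J × z ~ x
    p-edge = pendant-edge P
    q-edge : ∃ λ z → ∃ λ x → z ∈ Q.U × x ∈ Q.J × z ~ x
    q-edge = pendant-edge Q
    U∩V : ∀ {v} → v ∈ P.U → ¬ v ∈ Q.U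
    U∩V v∈U v∈V with P.U-near v∈U | Q.U-near v∈V
    ... | inj₁ refl | inj₁ refl = x≢y (is-distant f) refl
    ... | inj₁ refl | inj₂ y~x  = x≁y (is-distant f) (~-sym y~x)
    ... | inj₂ x~y  | inj₁ refl = x≁y (is-distant f) x~y
    ... | inj₂ x~v  | inj₂ y~v  = no-common (is-distant f) x~v y~v
    U∩K : ∀ {v} → v ∈ P.U → ¬ v ∈ Q.J
    U∩K v∈U v∈K = [ proj₁ (Q.J-far v∈K) , proj₂ (Q.J-far v∈K) ]′ (P.U-near v∈U)
    J∩V : ∀ {v} → v ∈ P.J → ¬ v ∈ Q.U
    J∩V v∈J v∈V = [ proj₁ (P.J-far v∈J) , proj₂ (P.J-far v∈J) ]′ (Q.U-near v∈V)
    -- The intersection is closed under adjacency because the other three combinations are empty; in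
    -- a connected graph it would therefore contain `y`.
    J∩K : ∀ {v} → v ∈ P.J → ¬ v ∈ Q.J
    J∩K {v} v∈J v∈K = proj₁ (P.J-far (proj₁ everywhere)) refl
      where
      everywhere : y ∈ P.J × y ∈ Q.J
      everywhere = connected-transport {u = v} {v = y} (λ v → v ∈ P.J × v ∈ Q.J) conn
        (λ _ _ e (u∈J , u∈K) → case P.J-closed u∈J e , Q.J-closed u∈K e of λ where
          (inj₂ v∈J , inj₂ v∈K) → v∈J , v∈K
          (inj₁ v∈U , inj₁ v∈V) → contradiction v∈V (U∩V v∈U)
          (inj₁ v∈U , inj₂ v∈K) → contradiction v∈K (U∩K v∈U)
          (inj₂ v∈J , inj₁ v∈V) → contradiction v∈V (J∩V v∈J))
        refl refl (v∈J , v∈K)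
    disjoint : ∀ {v} → v ∈ P.U ⊎ v ∈ P.J → ¬ (v ∈ Q.U ⊎ v ∈ Q.J)
    disjoint (inj₁ v∈U) = [ U∩V v∈U , U∩K v∈U ]′
    disjoint (inj₂ v∈J) = [ J∩V v∈J , J∩K v∈J ]′
    nonadjacent : ∀ {u v} → u ∈ P.U → v ∈ Q.U → ¬ u ~ v
    nonadjacent u∈U v∈V e with P.U-near u∈U | Q.U-near v∈V
    ... | inj₁ refl | inj₁ refl = x≁y (is-distant f) e
    ... | inj₁ refl | inj₂ y~v  = no-common (is-distant f) e y~v
    ... | inj₂ x~u  | inj₁ refl = no-common (is-distant f) x~u (~-sym e)
    ... | inj₂ x~u  | inj₂ y~v  = no-link f x~u y~v e

  -- Shortest walks

  -- Counted from the target because `step` appends there; past the length the value stays at the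
  -- source.
  from-end : ∀ {A k u v} → WalkIn G A k u v → ℕ → Fin n
  from-end (here {x} _) _ = x
  from-end (step {z = z} _ _ _) zero = z
  from-end (step w _ _) (suc i) = from-end w i

  from-end-zero : ∀ {A k u v} (w : WalkIn G A k u v) → from-end w 0 ≡ v
  from-end-zero (here _) = refl
  from-end-zero (step _ _ _) = refl

  from-end-last : ∀ {A k u v} (w : WalkIn G A k u v) → from-end w k ≡ u
  from-end-last (here _) = refl
  from-end-last (step w _ _) = from-end-last w

  from-end-edge : ∀ {A k u v} (w : WalkIn G A k u v) {i} → i < k → from-end w i ~ from-end w (suc i)
  from-end-edge (step w e _) {zero} _ = subst (_ ~_) (≡-sym (from-end-zero w)) (~-sym e)
  from-end-edge (step w _ _) {suc i} (s≤s i<k) = from-end-edge w i<k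

  suffix : ∀ {A k u v} (w : WalkIn G A k u v) {i} → i ≤ k → WalkIn G A i (from-end w i) v
  suffix (here u∈A) z≤n = here u∈A
  suffix (step _ _ z∈A) {zero} _ = here z∈A
  suffix (step w e z∈A) {suc i} (s≤s i≤k) = step (suffix w i≤k) e z∈A

  prefix : ∀ {A k u v} (w : WalkIn G A k u v) {i} → i ≤ k → ∃ λ j → j + i ≡ k × WalkIn G A j u (from-end w i)
  prefix (here u∈A) z≤n = 0 , refl , here u∈A
  prefix {k = k} (step w e z∈A) {zero} _ = k , ℕ.+-identityʳ k , step w e z∈A
  prefix (step w _ _) {suc i} (s≤s i≤k) with j , eq , w′ ← prefix w i≤k = j , trans (ℕ.+-suc j i) (cong suc eq) , w′

  Shortest : ∀ {A k u v} → WalkIn G A k u v → Set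
  Shortest {A} {k} {u} {v} _ = ∀ {j} → j < k → ¬ WalkIn G A j u v

  shortest-walk : ∀ {A u v} → ReachIn G A u v → ¬ ¬ (∃ λ k → Σ (WalkIn G A k u v) Shortest)
  shortest-walk {A} {u} {v} (k , w) none =
    <-rec (λ k → ¬ WalkIn G A k u v) (λ k ih w → none (k , w , ih)) k w

  -- Joined to the part of `w` before this vertex, a shorter walk to `v` would shorten the whole.
  shortest-suffix : ∀ {A k u v} {w : WalkIn G A k u v} → Shortest w →
    ∀ {i j} → i ≤ k → j < i → ¬ WalkIn G A j (from-end w i) v
  shortest-suffix {k = k} {w = w} short {i} {j} i≤k j<i w′ with l , eq , w″ ← prefix w i≤k =
    short (subst (j + l <_) (trans (ℕ.+-comm i l) eq) (ℕ.+-monoˡ-< l j<i)) (w″ ++ʷ w′)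

  from-end-injective : ∀ {A k u v} {w : WalkIn G A k u v} → Shortest w →
    ∀ {i j} → i ≤ k → j ≤ k → from-end w i ≡ from-end w j → i ≡ j
  from-end-injective {A} {v = v} {w = w} short {i} {j} i≤k j≤k e with ℕ.<-cmp i j
  ... | tri≈ _ i≡j _ = i≡j
  ... | tri< i<j _ _ = ⊥-elim (shortest-suffix {w = w} short j≤k i<j (subst (λ u → WalkIn G A i u v) e (suffix w i≤k)))
  ... | tri> _ _ j<i = ⊥-elim (shortest-suffix {w = w} short i≤k j<i (subst (λ u → WalkIn G A j u v) (≡-sym e) (suffix w j≤k)))

  -- A chord skipping vertices would replace a suffix of length `j` by one of length `i + 1`.
  from-end-induced : ∀ {A k u v} {w : WalkIn G A k u v} → Shortest w →
    ∀ {i j} → i ≤ k → j ≤ k → from-end w i ~ from-end w j → i < j → suc i ≡ j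
  from-end-induced {w = w} short {i} {j} i≤k j≤k e i<j with ℕ.m≤n⇒m<n∨m≡n i<j
  ... | inj₂ eq = eq
  ... | inj₁ 1+i<j = ⊥-elim (shortest-suffix {w = w} short j≤k (subst (_< j) (ℕ.+-comm 1 i) 1+i<j)
          (step (here (walk-source (suffix w j≤k))) (~-sym e) (walk-source (suffix w i≤k)) ++ʷ suffix w i≤k))

  -- A cyclic order of the vertices

  module Cycle {x a b a′ b′} (nice : Nice x) (x~a : x ~ a) (x~b : x ~ b) (a≢b : a ≢ b)
    (x-only : ∀ {v} → x ~ v → v ≡ a ⊎ v ≡ b)
    (a~a′ : a ~ a′) (a-only : ∀ {v} → a ~ v → v ≡ x ⊎ v ≡ a′)
    (b~b′ : b ~ b′) (b-only : ∀ {v} → b ~ v → v ≡ x ⊎ v ≡ b′)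
    {k} (w : WalkIn G (H x) k a′ b′) (short : Shortest w) where

    p : ℕ → Fin n
    p = from-end w

    -- `p` starts at `b′` and ends at `a′`, so the order `a`, `x`, `b`, `p 0`, ..., `p k` closes up;
    -- its length `4 + k` counts the `k + 1` walk vertices and three more.
    f : ℕ → Fin n
    f 0 = a
    f 1 = x
    f 2 = b
    f (suc (suc (suc i))) = p i

    p∈H : ∀ {i} → i ≤ k → p i ∈ H x
    p∈H i≤k = walk-source (suffix w i≤k)

    p≢x : ∀ {i} → i ≤ k → p i ≢ x
    p≢x i≤k = proj₁ (∈H⁻ (p∈H i≤k))

    x≁p : ∀ {i} → i ≤ k → ¬ x ~ p i
    x≁p i≤k = proj₂ (∈H⁻ (p∈H i≤k))

    K? : ∀ v → Dec (∃ λ (i : Fin (suc k)) → p (toℕ i) ≡ v)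
    K? v = any? λ i → p (toℕ i) ≟ v

    p∈K : ∀ {i} → i ≤ k → p i ∈ ⟦ K? ⟧
    p∈K i≤k = ∈⁺ K? (fromℕ< (s≤s i≤k) , cong p (Fin.toℕ-fromℕ< (s≤s i≤k)))

    K-index : ∀ {v} → v ∈ ⟦ K? ⟧ → ∃ λ i → i ≤ k × p i ≡ v
    K-index v∈K with i , e ← ∈⁻ K? v∈K = toℕ i , ℕ.≤-pred (Fin.toℕ<n i) , e

    K-connected : ConnectedIn G ⟦ K? ⟧
    K-connected = hub⇒connected (p∈K z≤n) λ v∈K → case K-index v∈K of λ where
        (i , i≤k , refl) → reach i i≤k
      where
      reach : ∀ i → i ≤ k → ReachIn G ⟦ K? ⟧ (p 0) (p i)
      reach zero i≤k = _ , here (p∈K i≤k)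
      reach (suc i) i<k = reach-trans (reach i (ℕ.<⇒≤ i<k))
        (reach-edge (p∈K (ℕ.<⇒≤ i<k)) (p∈K i<k) (from-end-edge w i<k))

    -- In `H x` only `a′` and `b′` are adjacent to a neighbour of `x`, and the walk joins them, so
    -- minimality leaves no other vertex.
    H⊆K : H x ⊆ ⟦ K? ⟧
    H⊆K = H-minimal nice K-connected
      (λ v v∈K → case K-index v∈K of λ { (i , i≤k , refl) → p∈H i≤k }) contact
      where
      contact : ∀ {q h} → x ~ q → q ~ h → h ∈ H x → h ∈ ⟦ K? ⟧
      contact x~q q~h h∈H with x-only x~q
      contact x~q q~h h∈H | inj₁ refl with a-only q~h
      ... | inj₁ h≡x = contradiction h≡x (proj₁ (∈H⁻ h∈H))
      ... | inj₂ refl = subst (_∈ ⟦ K? ⟧) (from-end-last w) (p∈K ℕ.≤-refl)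
      contact x~q q~h h∈H | inj₂ refl with b-only q~h
      ... | inj₁ h≡x = contradiction h≡x (proj₁ (∈H⁻ h∈H))
      ... | inj₂ refl = subst (_∈ ⟦ K? ⟧) (from-end-zero w) (p∈K z≤n)

    m : ℕ
    m = 4 + k

    pattern 3+ i = suc (suc (suc i))

    bound : ∀ {i} → 3+ i < m → i ≤ k
    bound (s≤s (s≤s (s≤s (s≤s i≤k)))) = i≤k

    f-surjective : ∀ v → ∃ λ i → i < m × f i ≡ v
    f-surjective v with trichotomy x v
    ... | inj₁ e = 1 , s≤s (s≤s z≤n) , ≡-sym e
    ... | inj₂ (inj₂ v∈H) = let i , i≤k , e = K-index (H⊆K v v∈H) in 3+ i , s≤s (s≤s (s≤s (s≤s i≤k))) , e
    ... | inj₂ (inj₁ x~v) with x-only x~v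
    ...   | inj₁ e = 0 , s≤s z≤n , ≡-sym e
    ...   | inj₂ e = 2 , s≤s (s≤s (s≤s z≤n)) , ≡-sym e

    p≢nbr : ∀ {i v} → i ≤ k → x ~ v → v ≢ p i
    p≢nbr i≤k x~v refl = x≁p i≤k x~v

    f-injective : ∀ {i j} → i < m → j < m → f i ≡ f j → i ≡ j
    f-injective {0} {0} _ _ e = refl
    f-injective {0} {1} _ _ e = contradiction (≡-sym e) (~⇒≢ x~a)
    f-injective {0} {2} _ _ e = contradiction e a≢b
    f-injective {0} {3+ j} _ j<m e = contradiction e (p≢nbr (bound j<m) x~a)
    f-injective {1} {0} _ _ e = contradiction e (~⇒≢ x~a)
    f-injective {1} {1} _ _ e = refl
    f-injective {1} {2} _ _ e = contradiction e (~⇒≢ x~b)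
    f-injective {1} {3+ j} _ j<m e = contradiction (≡-sym e) (p≢x (bound j<m))
    f-injective {2} {0} _ _ e = contradiction (≡-sym e) a≢b
    f-injective {2} {1} _ _ e = contradiction (≡-sym e) (~⇒≢ x~b)
    f-injective {2} {2} _ _ e = refl
    f-injective {2} {3+ j} _ j<m e = contradiction e (p≢nbr (bound j<m) x~b)
    f-injective {3+ i} {0} i<m _ e = contradiction (≡-sym e) (p≢nbr (bound i<m) x~a)
    f-injective {3+ i} {1} i<m _ e = contradiction e (p≢x (bound i<m))
    f-injective {3+ i} {2} i<m _ e = contradiction (≡-sym e) (p≢nbr (bound i<m) x~b)
    f-injective {3+ i} {3+ j} i<m j<m e =
      cong (λ i → 3+ i) (from-end-injective {w = w} short (bound i<m) (bound j<m) e)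

    -- `CycStep` on plain numbers with `m` fixed, which allows matching on small indices.
    Next : ℕ → ℕ → Set
    Next i j = suc i ≡ j ⊎ (suc i ≡ m × j ≡ 0)

    next⇒adj : ∀ {i j} → i < m → j < m → Next i j → f i ~ f j
    next⇒adj {0} _ _ (inj₁ refl) = ~-sym x~a
    next⇒adj {1} _ _ (inj₁ refl) = x~b
    next⇒adj {2} _ _ (inj₁ refl) = subst (b ~_) (≡-sym (from-end-zero w)) b~b′
    next⇒adj {3+ i} _ j<m (inj₁ refl) = from-end-edge w (bound j<m)
    next⇒adj {3+ i} _ _ (inj₂ (refl , refl)) = subst (_~ a) (≡-sym (from-end-last w)) (~-sym a~a′)

    adj⇒next : ∀ {i j} → i < j → j < m → f i ~ f j → Next i j ⊎ Next j i
    adj⇒next {0} {1} _ _ _ = inj₁ (inj₁ refl)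
    adj⇒next {0} {2} _ _ e = ⊥-elim (triangle-free _ _ _ x~a e x~b)
    adj⇒next {0} {3+ j} _ j<m e with a-only e
    ... | inj₁ e′ = contradiction e′ (p≢x (bound j<m))
    -- `a` is adjacent to the walk only at `a′`, its vertex `p k`: this is the closing edge.
    ... | inj₂ e′ = inj₂ (inj₂ (cong (4 +_) (from-end-injective {w = w} short (bound j<m) ℕ.≤-refl
                      (trans e′ (≡-sym (from-end-last w)))) , refl))
    adj⇒next {1} {2} _ _ _ = inj₁ (inj₁ refl)
    adj⇒next {1} {3+ j} _ j<m e = contradiction e (x≁p (bound j<m))
    adj⇒next {2} {3+ j} _ j<m e with b-only e
    ... | inj₁ e′ = contradiction e′ (p≢x (bound j<m))
    ... | inj₂ e′ = inj₁ (inj₁ (cong (3 +_) (from-end-injective {w = w} short z≤n (bound j<m)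
                      (trans (from-end-zero w) (≡-sym e′)))))
    adj⇒next {3+ i} {3+ j} (s≤s (s≤s (s≤s i<j))) j<m e =
      inj₁ (inj₁ (cong (3 +_) (from-end-induced {w = w} short (ℕ.≤-trans (ℕ.<⇒≤ i<j) (bound j<m)) (bound j<m) e i<j)))
    adj⇒next {1} {1} (s≤s ()) _ _
    adj⇒next {2} {1} (s≤s ()) _ _
    adj⇒next {2} {2} (s≤s (s≤s ())) _ _
    adj⇒next {3+ i} {1} (s≤s ()) _ _
    adj⇒next {3+ i} {2} (s≤s (s≤s ())) _ _

    adjacency : ∀ (i j : Fin m) → (f (toℕ i) ~ f (toℕ j)) ⇔ CycAdj i j
    adjacency i j = mk⇔ to
      [ next⇒adj (Fin.toℕ<n i) (Fin.toℕ<n j) , ~-sym ∘ next⇒adj (Fin.toℕ<n j) (Fin.toℕ<n i) ]′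
      where
      to : f (toℕ i) ~ f (toℕ j) → CycAdj i j
      to e with ℕ.<-cmp (toℕ i) (toℕ j)
      ... | tri< i<j _ _ = adj⇒next i<j (Fin.toℕ<n j) e
      ... | tri≈ _ i≡j _ = contradiction (cong f i≡j) (~⇒≢ e)
      ... | tri> _ _ j<i = [ inj₂ , inj₁ ]′ (adj⇒next j<i (Fin.toℕ<n i) (~-sym e))

    is-cycle : IsCycle G
    is-cycle = cycle-intro G (f ∘ toℕ)
      (λ {i} {j} e → Fin.toℕ-injective (f-injective (Fin.toℕ<n i) (Fin.toℕ<n j) e))
      (λ v → let i , i<m , e = f-surjective v in
             fromℕ< i<m , trans (cong f (Fin.toℕ-fromℕ< i<m)) e)
      (s≤s (s≤s (s≤s z≤n))) adjacency

  -- Niceness at distance four, and the conclusion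

  other-neighbour : ∀ {a x} → Nice a → a ~ x → ∃ λ a′ → a ~ a′ × a′ ≢ x × (∀ {v} → a ~ v → v ≡ x ⊎ v ≡ a′)
  other-neighbour nice a~x with nice⇒degree-2 nice a~x
  ... | inj₁ refl = q₂ nice , x~q₂ nice , ≢-sym (q₁≢q₂ nice) , nice⇒degree-2 nice
  ... | inj₂ refl = q₁ nice , x~q₁ nice , q₁≢q₂ nice , [ inj₂ , inj₁ ]′ ∘ nice⇒degree-2 nice

  -- `x` and both its neighbours lie at distance at least 3 from `y`, hence are nice with two
  -- neighbours each; triangle-freeness puts the outer neighbours `a′` and `b′` in `H x`, where a
  -- shortest walk joins them.
  far-from-nice : ∀ {x y} → ¬ IsCycle G → Far x y → ¬ Nice y
  far-from-nice {x} ¬cycle f nice-y =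
    distant⇒nice nice-y (is-distant f) λ nice →
    distant⇒nice nice-y (far⇒nbr-distant f (x~q₁ nice)) λ nice-a →
    distant⇒nice nice-y (far⇒nbr-distant f (x~q₂ nice)) λ nice-b →
    let a′ , a~a′ , a′≢x , a-only = other-neighbour nice-a (~-sym (x~q₁ nice))
        b′ , b~b′ , b′≢x , b-only = other-neighbour nice-b (~-sym (x~q₂ nice))
        a′∈H = ∈H⁺ a′≢x (triangle-free _ _ _ (x~q₁ nice) a~a′)
        b′∈H = ∈H⁺ b′≢x (triangle-free _ _ _ (x~q₂ nice) b~b′)
    in shortest-walk (proj₂ (H-connected nice) a′ b′ a′∈H b′∈H) λ (_ , w , short) →
       ¬cycle (Cycle.is-cycle nice (x~q₁ nice) (x~q₂ nice) (q₁≢q₂ nice) (nice⇒degree-2 nice)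
                 a~a′ a-only b~b′ b-only w short)

  no-far : ∀ {x y} → ¬ IsCycle G → ¬ Far x y
  no-far ¬cycle f = pendant-or-nice (is-distant f) λ where
    (inj₂ nice) → far-from-nice ¬cycle (far-sym f) nice
    (inj₁ P) → pendant-or-nice (is-distant (far-sym f)) λ where
      (inj₂ nice) → far-from-nice ¬cycle f nice
      (inj₁ Q) → no-far-pendants f P Q

  short-or-far : ∀ x y → (∃ λ k → k ≤ 3 × WalkIn G full k x y) ⊎ Far x y
  short-or-far x y with x ≟ y | x ~? y | any? (λ p → (x ~? p) ×-dec (y ~? p))
    | any? (λ p → any? (λ q → (x ~? p) ×-dec (y ~? q) ×-dec (p ~? q)))
  ... | yes refl | _ | _ | _ = inj₁ (0 , z≤n , here refl)
  ... | no _ | yes e | _ | _ = inj₁ (1 , s≤s z≤n , step (here refl) e refl)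
  ... | no _ | no _ | yes (p , e , e′) | _ =
    inj₁ (2 , s≤s (s≤s z≤n) , step (step (here refl) e refl) (~-sym e′) refl)
  ... | no _ | no _ | no _ | yes (p , q , e , e′ , e″) =
    inj₁ (3 , s≤s (s≤s (s≤s z≤n)) , step (step (step (here refl) e refl) e″ refl) (~-sym e′) refl)
  ... | no x≢y | no x≁y | no ¬common | no ¬link =
    inj₂ (far (distant x≢y x≁y (λ e e′ → ¬common (_ , e , e′))) (λ e e′ e″ → ¬link (_ , _ , e , e′ , e″)))

theorem1p4 : ∀ {n} (G : Graph n) → TriangleFree G → Connected G → InGcs G →
    ¬ IsCycle G → DiamLe G 3
theorem1p4 G triangle-free conn gcs ¬cycle x y = [ id , ⊥-elim ∘ no-far ¬cycle ]′ (short-or-far x y)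
  where open Gcs G triangle-free conn gcs
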